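{- Let $F$ be a sufficiently saturated model of a dimensional theory expanding the theory of fields, with dimension $\delta$. Let $Y\subseteq F$ be a type-definable subset (over a small set of parameters) satisfying $0<\delta(YY-Y)=\delta(Y)<\infty$. Then $\frac{Y-Y}{Y-Y}$ is a definable field (a definable subfield of $F$), and $\delta\left(\frac{Y-Y}{Y-Y}\right)=\delta(Y)$.
   Context: Dimension. Let $T$ be a complete first-order theory and $M\models T$. "Definable" means definable with parameters; $\operatorname{Def}(M)$ is the collection of sets definable in $M$ (subsets of finite Cartesian powers of $M$) with parameters from $M$. A (continuous, real-valued) dimension is a function $\delta:\operatorname{Def}(M)\to\mathbb{R}_{\ge 0}\cup\{+\infty\}$ such that for all definable $X,Y$: (1) $\delta(X\cup Y)=\max\{\delta(X),\delta(Y)\}$; (2) $\delta(X\times Y)=\delta(X)+\delta(Y)$ for $X,Y$ nonempty; (3) $\delta(X)=0$ if $X$ is finite; (4) $\delta(X\cap Y)\le\min\{\delta(X),\delta(Y)\}$; (5) for every definable surjection $f:X\to Y$ between nonempty sets, $\delta(Y)+\inf_{y\in Y}\delta(f^{ -1}(y))\le\delta(X)\le\delta(Y)+\sup_{y\in Y}\delta(f^{ -1}(y))$; and (continuity) for every formula $\phi(\bar x,\bar y)$ and reals $s<t$ there is a $\emptyset$-definable set $D$ with $\{a:\delta(\phi(\bar x,a))\le s\}\subseteq D\subseteq\{b:\delta(\phi(\bar x,b))<t\}$. $T$ is a dimensional theory if some model has such a $\delta$; by continuity $\delta(\phi(\bar x,a))$ depends only on $\operatorname{tp}(a/\emptyset)$,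 so $\delta$ transfers uniquely to all models of $T$ and is called the dimension of $T$. Partial types. A partial type is a consistent collection of formulas, possibly with parameters; a type-definable set is the set of realizations of a partial type over a small parameter set, in the saturated model. For a partial type $\Gamma$, $\delta(\Gamma)=\inf\{\delta(\phi):\Gamma\models\phi\}$. Set operations. For subsets $X,Y$ of a field, $X\pm Y=\{x\pm y\}$, $XY=\{xy\}$, with $x\in X,y\in Y$ (so $YY-Y=\{yy'-y'':y,y',y''\in Y\}$), and $\frac{X}{Y}=\{x/y:x\in X,\ y\in Y\setminus\{0\}\}$. -}

module Defs where

open import Level using (Level; Lift; lift) renaming (suc to lsuc)
open import Algebra.Structures using (IsCommutativeRing)
open import Data.Empty.Polymorphic using (⊥)
open import Data.Fin.Base using (Fin)
open import Data.List.Base using (List)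
open import Data.List.Membership.Propositional using () renaming (_∈_ to _∈ᴸ_)
open import Data.List.Relation.Unary.All using (All)
open import Data.Nat.Base as ℕ using (ℕ; zero; suc)
open import Data.Product.Base using (Σ; Σ-syntax; ∃; ∃-syntax; _×_; _,_; proj₁; proj₂)
open import Data.Rational.Base as ℚ using (ℚ; 0ℚ)
import Data.Rational.Properties as ℚₚ
open import Data.Sum.Base using (_⊎_; inj₁; inj₂)
open import Data.Vec.Base using (Vec; []; _∷_; _++_; head; lookup; map; take; drop)
open import Function.Base using (id)
open import Relation.Binary.PropositionalEquality using (_≡_; _≢_)
open import Relation.Nullary.Negation using (¬_)
open import Relation.Unary using (Pred; _⊆_; _≐_; _∪_; _∩_; Satisfiable)

------------------------------------------------------------------------
-- ℝ≥0 ∪ {+∞}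

-- x ∈ [0,∞] is represented by its upper cut { q ∈ ℚ ∣ q > x }.  Under excluded
-- middle (assumed where these are used) this is a bijection between [0,∞] and
-- such cuts up to _≈_; the empty cut is +∞.
record ℝ≥0∞ (ℓ : Level) : Set (lsuc ℓ) where
  field
    cut      : Pred ℚ ℓ
    positive : ∀ {q} → cut q → 0ℚ ℚ.< q
    upper    : ∀ {p q} → cut p → p ℚ.≤ q → cut q
    rounded  : ∀ {q} → cut q → ∃[ p ] p ℚ.< q × cut p

open ℝ≥0∞ public

module _ {ℓ : Level} where

  infix  4 _≤_ _<_ _≈_
  infixl 6 _+_ _⊔_ _⊓_

  _≤_ _≈_ _<_ : ℝ≥0∞ ℓ → ℝ≥0∞ ℓ → Set ℓ
  x ≤ y = cut y ⊆ cut x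
  x ≈ y = x ≤ y × y ≤ x
  -- x < q ≤ y for some rational q
  x < y = ∃[ q ] cut x q × ¬ cut y q

  0∞ : ℝ≥0∞ ℓ
  0∞ .cut q = Lift ℓ (0ℚ ℚ.< q)
  0∞ .positive (lift 0<q) = 0<q
  0∞ .upper (lift 0<p) p≤q = lift (ℚₚ.<-≤-trans 0<p p≤q)
  0∞ .rounded (lift 0<q) with ℚₚ.<-dense 0<q
  ... | p , 0<p , p<q = p , p<q , lift 0<p

  ∞ : ℝ≥0∞ ℓ
  ∞ .cut _ = ⊥
  ∞ .positive ()
  ∞ .upper ()
  ∞ .rounded ()

  _+_ : ℝ≥0∞ ℓ → ℝ≥0∞ ℓ → ℝ≥0∞ ℓ
  (x + y) .cut r = ∃[ p ] ∃[ q ] cut x p × cut y q × p ℚ.+ q ℚ.≤ r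
  (x + y) .positive (p , q , xp , yq , p+q≤r) =
    ℚₚ.<-≤-trans (ℚₚ.+-mono-< (positive x xp) (positive y yq)) p+q≤r
  (x + y) .upper (p , q , xp , yq , p+q≤r) r≤s =
    p , q , xp , yq , ℚₚ.≤-trans p+q≤r r≤s
  (x + y) .rounded (p , q , xp , yq , p+q≤r) with rounded x xp
  ... | p′ , p′<p , xp′ =
    p′ ℚ.+ q , ℚₚ.<-≤-trans (ℚₚ.+-monoˡ-< q p′<p) p+q≤r ,
    p′ , q , xp′ , yq , ℚₚ.≤-refl

  _⊔_ : ℝ≥0∞ ℓ → ℝ≥0∞ ℓ → ℝ≥0∞ ℓ
  (x ⊔ y) .cut q = cut x q × cut y q
  (x ⊔ y) .positive (xq , _) = positive x xq
  (x ⊔ y) .upper (xp , yp) p≤q = upper x xp p≤q , upper y yp p≤q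
  (x ⊔ y) .rounded (xq , yq) with rounded x xq | rounded y yq
  ... | p , p<q , xp | p′ , p′<q , yp′ with ℚₚ.≤-total p p′
  ... | inj₁ p≤p′ = p′ , p′<q , upper x xp p≤p′ , yp′
  ... | inj₂ p′≤p = p , p<q , xp , upper y yp′ p′≤p

  _⊓_ : ℝ≥0∞ ℓ → ℝ≥0∞ ℓ → ℝ≥0∞ ℓ
  (x ⊓ y) .cut q = cut x q ⊎ cut y q
  (x ⊓ y) .positive (inj₁ xq) = positive x xq
  (x ⊓ y) .positive (inj₂ yq) = positive y yq
  (x ⊓ y) .upper (inj₁ xp) p≤q = inj₁ (upper x xp p≤q)
  (x ⊓ y) .upper (inj₂ yp) p≤q = inj₂ (upper y yp p≤q)
  (x ⊓ y) .rounded (inj₁ xq) with rounded x xq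
  ... | p , p<q , xp = p , p<q , inj₁ xp
  (x ⊓ y) .rounded (inj₂ yq) with rounded y yq
  ... | p , p<q , yp = p , p<q , inj₂ yp

  inf sup : {I : Set ℓ} → (I → ℝ≥0∞ ℓ) → ℝ≥0∞ ℓ

  inf x .cut q = ∃[ i ] cut (x i) q
  inf x .positive (i , xq) = positive (x i) xq
  inf x .upper (i , xp) p≤q = i , upper (x i) xp p≤q
  inf x .rounded (i , xq) with rounded (x i) xq
  ... | p , p<q , xp = p , p<q , i , xp

  -- q > sup x iff some positive p < q satisfies p > x i for every i; the
  -- intersection of the cuts of the x i need not itself be rounded.
  sup x .cut q = ∃[ p ] 0ℚ ℚ.< p × p ℚ.< q × (∀ i → cut (x i) p)
  sup x .positive (p , 0<p , p<q , _) = ℚₚ.<-trans 0<p p<q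
  sup x .upper (p , 0<p , p<q , xp) q≤r = p , 0<p , ℚₚ.<-≤-trans p<q q≤r , xp
  sup x .rounded (p , 0<p , p<q , xp) with ℚₚ.<-dense p<q
  ... | r , p<r , r<q = r , r<q , p , 0<p , p<r , xp

------------------------------------------------------------------------
-- First-order logic

record Language (ℓ : Level) : Set (lsuc ℓ) where
  field
    Func : ℕ → Set ℓ
    Rel  : ℕ → Set ℓ

module _ {ℓ : Level} (L : Language ℓ) where
  open Language L

  data Term (n : ℕ) : Set ℓ where
    var : Fin n → Term n
    fun : ∀ {k} → Func k → Vec (Term n) k → Term n

  data Formula (n : ℕ) : Set ℓ where
    _≐̇_         : Term n → Term n → Formula n
    rel         : ∀ {k} → Rel k → Vec (Term n) k → Formula n
    ⊥̇           : Formula n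
    _∧̇_ _∨̇_ _⇒̇_ : Formula n → Formula n → Formula n
    ∃̇ ∀̇         : Formula (suc n) → Formula n

  Sentence : Set ℓ
  Sentence = Formula 0

  record Structure : Set (lsuc ℓ) where
    field
      Carrier : Set ℓ
      ⟦_⟧ᶠ    : ∀ {k} → Func k → Vec Carrier k → Carrier
      ⟦_⟧ʳ    : ∀ {k} → Rel k → Vec Carrier k → Set ℓ

  -- Formulas in n variables with parameters named by elements of C.  The
  -- parameters are substituted for the last variables.
  FormulaOver : Set ℓ → ℕ → Set ℓ
  FormulaOver C n = Σ[ k ∈ ℕ ] Formula (n ℕ.+ k) × Vec C k

  Theory : Set (lsuc ℓ)
  Theory = Pred Sentence ℓ

module _ {ℓ : Level} {L : Language ℓ} where

  module _ (M : Structure L) where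
    open Structure M

    eval  : ∀ {n} → Term L n → Vec Carrier n → Carrier
    evals : ∀ {n k} → Vec (Term L n) k → Vec Carrier n → Vec Carrier k
    eval (var i)    v = lookup v i
    eval (fun f ts) v = ⟦ f ⟧ᶠ (evals ts v)
    evals []       v = []
    evals (t ∷ ts) v = eval t v ∷ evals ts v

    Sat : ∀ {n} → Formula L n → Pred (Vec Carrier n) ℓ
    Sat (s ≐̇ t)    v = eval s v ≡ eval t v
    Sat (rel R ts) v = ⟦ R ⟧ʳ (evals ts v)
    Sat ⊥̇          v = ⊥
    Sat (φ ∧̇ ψ)    v = Sat φ v × Sat ψ v
    Sat (φ ∨̇ ψ)    v = Sat φ v ⊎ Sat ψ v
    Sat (φ ⇒̇ ψ)    v = Sat φ v → Sat ψ v
    Sat (∃̇ φ)      v = ∃[ x ] Sat φ (x ∷ v)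
    Sat (∀̇ φ)      v = ∀ x → Sat φ (x ∷ v)

    ⟪_⟫ : ∀ {n} → FormulaOver L Carrier n → Pred (Vec Carrier n) ℓ
    ⟪ k , φ , b ⟫ v = Sat φ (v ++ b)

    SatOver : ∀ {C : Set ℓ} {n} → (C → Carrier) → FormulaOver L C n → Pred (Vec Carrier n) ℓ
    SatOver a (k , φ , c) = ⟪ k , φ , map a c ⟫

    Definable : ∀ {n} → Pred (Vec Carrier n) ℓ → Set ℓ
    Definable {n} X = Σ[ ψ ∈ FormulaOver L Carrier n ] X ≐ ⟪ ψ ⟫

    -- Realizations of a set of formulas whose parameters are named by C.
    Realizes : ∀ {C : Set ℓ} {n} → (C → Carrier) → Pred (FormulaOver L C n) ℓ →
               Pred (Vec Carrier n) ℓ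
    Realizes a Γ v = ∀ {ψ} → Γ ψ → SatOver a ψ v

    -- Consistency with the elementary diagram of M, i.e. finite satisfiability.
    Consistent : ∀ {C : Set ℓ} {n} → (C → Carrier) → Pred (FormulaOver L C n) ℓ → Set ℓ
    Consistent {C} {n} a Γ =
      (ψs : List (FormulaOver L C n)) → All Γ ψs →
      ∃[ v ] All (λ ψ → SatOver a ψ v) ψs

    -- "Small" means of cardinality at most ∣K∣: a small parameter set is the
    -- range of a family K → Carrier.  Thus this is ∣K∣⁺-saturation.
    Saturated : Set ℓ → Set (lsuc ℓ)
    Saturated K = ∀ {n} (a : K → Carrier) (Γ : Pred (FormulaOver L K n) ℓ) →
                  Consistent a Γ → Satisfiable (Realizes a Γ)

    TypeDefinable : Set ℓ → ∀ {n} → Pred (Vec Carrier n) ℓ → Set (lsuc ℓ)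
    TypeDefinable K {n} X =
      Σ[ a ∈ (K → Carrier) ] Σ[ Γ ∈ Pred (FormulaOver L K n) ℓ ]
        Consistent a Γ × X ≐ Realizes a Γ

  infix 4 _⊨_ _⊩_

  _⊨_ : Structure L → Theory L → Set ℓ
  M ⊨ T = ∀ {σ} → T σ → Sat M σ []

  _⊩_ : Theory L → Sentence L → Set (lsuc ℓ)
  T ⊩ σ = ∀ M → M ⊨ T → Sat M σ []

  Complete : Theory L → Set (lsuc ℓ)
  Complete T = (Σ[ M ∈ Structure L ] M ⊨ T) × (∀ σ → T ⊩ σ ⊎ T ⊩ (σ ⇒̇ ⊥̇))

------------------------------------------------------------------------
-- Dimension

  Finite : ∀ {A : Set ℓ} → Pred A ℓ → Set ℓ
  Finite X = ∃[ xs ] (∀ {x} → X x → x ∈ᴸ xs)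

  ⟪⟫-definable : (M : Structure L) {n : ℕ} (ψ : FormulaOver L (Structure.Carrier M) n) →
    Definable M (⟪_⟫ M ψ)
  ⟪⟫-definable M ψ = ψ , id , id

  record Dimension (M : Structure L) : Set (lsuc ℓ) where
    open Structure M

    -- The value of δ on X is taken at a proof that X is definable; by δ-cong it
    -- depends on X only.
    field
      δ : ∀ {n} {X : Pred (Vec Carrier n) ℓ} → Definable M X → ℝ≥0∞ ℓ

      δ-cong : ∀ {n} {X Y : Pred (Vec Carrier n) ℓ}
        (dX : Definable M X) (dY : Definable M Y) → X ≐ Y → δ dX ≈ δ dY

      δ-∪ : ∀ {n} {X Y : Pred (Vec Carrier n) ℓ}
        (dX : Definable M X) (dY : Definable M Y) (dX∪Y : Definable M (X ∪ Y)) →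
        δ dX∪Y ≈ δ dX ⊔ δ dY

      δ-× : ∀ {n m} {X : Pred (Vec Carrier n) ℓ} {Y : Pred (Vec Carrier m) ℓ}
        (dX : Definable M X) (dY : Definable M Y)
        (dX×Y : Definable M (λ v → X (take n v) × Y (drop n v))) →
        Satisfiable X → Satisfiable Y →
        δ dX×Y ≈ δ dX + δ dY

      δ-finite : ∀ {n} {X : Pred (Vec Carrier n) ℓ} (dX : Definable M X) →
        Finite X → δ dX ≈ 0∞

      δ-∩ : ∀ {n} {X Y : Pred (Vec Carrier n) ℓ}
        (dX : Definable M X) (dY : Definable M Y) (dX∩Y : Definable M (X ∩ Y)) →
        δ dX∩Y ≤ δ dX ⊓ δ dY

      -- Definable surjections X → Y; the values of f outside X are irrelevant.
      δ-fibres : ∀ {n m} {X : Pred (Vec Carrier n) ℓ} {Y : Pred (Vec Carrier m) ℓ}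
        (dX : Definable M X) (dY : Definable M Y) → Satisfiable X → Satisfiable Y →
        (f : Vec Carrier n → Vec Carrier m) →
        Definable M (λ v → X (take n v) × f (take n v) ≡ drop n v) →
        (∀ {x} → X x → Y (f x)) →
        (∀ {y} → Y y → ∃[ x ] X x × f x ≡ y) →
        (dfib : ∀ y → Definable M (λ x → X x × f x ≡ y)) →
        δ dY + inf {I = ∃ Y} (λ y → δ (dfib (proj₁ y))) ≤ δ dX ×
        δ dX ≤ δ dY + sup {I = ∃ Y} (λ y → δ (dfib (proj₁ y)))

      -- Negative s need no mention: D may then be empty.
      δ-continuous : ∀ {n m} (φ : Formula L (n ℕ.+ m)) (s t : ℝ≥0∞ ℓ) → s < t → t < ∞ →
        Σ[ D ∈ Formula L m ]
          (∀ a → δ (⟪⟫-definable M {n} (m , φ , a)) ≤ s → Sat M D a) ×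
          (∀ b → Sat M D b → δ (⟪⟫-definable M {n} (m , φ , b)) < t)

    -- The dimension of a type-definable set X in a saturated model: the formulas
    -- entailed by a partial type defining X are those satisfied on all of X.
    δᵗ : ∀ {n} → Pred (Vec Carrier n) ℓ → ℝ≥0∞ ℓ
    δᵗ {n} X =
      inf {I = Σ[ ψ ∈ FormulaOver L Carrier n ] X ⊆ ⟪_⟫ M ψ}
          (λ (ψ , _) → δ (⟪⟫-definable M ψ))

------------------------------------------------------------------------
-- Fields

record RingSymbols {ℓ : Level} (L : Language ℓ) : Set ℓ where
  open Language L
  field
    zeroˢ oneˢ : Func 0
    plusˢ mulˢ : Func 2
    negˢ       : Func 1

module FieldOps {ℓ : Level} {L : Language ℓ} (S : RingSymbols L) (M : Structure L) where
  open RingSymbols S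
  open Structure M

  infixl 6 _⊕_ _⊖_
  infixl 7 _⊗_

  0ᶠ 1ᶠ : Carrier
  0ᶠ = ⟦ zeroˢ ⟧ᶠ []
  1ᶠ = ⟦ oneˢ ⟧ᶠ []

  _⊕_ _⊗_ _⊖_ : Carrier → Carrier → Carrier
  x ⊕ y = ⟦ plusˢ ⟧ᶠ (x ∷ y ∷ [])
  x ⊗ y = ⟦ mulˢ ⟧ᶠ (x ∷ y ∷ [])

  ⊝_ : Carrier → Carrier
  ⊝ x = ⟦ negˢ ⟧ᶠ (x ∷ [])

  x ⊖ y = x ⊕ (⊝ y)

  record IsField : Set ℓ where
    field
      isCommutativeRing : IsCommutativeRing _≡_ _⊕_ _⊗_ ⊝_ 0ᶠ 1ᶠ
      0≢1               : 0ᶠ ≢ 1ᶠ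
      inverse           : ∀ x → x ≢ 0ᶠ → ∃[ y ] x ⊗ y ≡ 1ᶠ

  record IsSubfield (Q : Pred Carrier ℓ) : Set ℓ where
    field
      0∈         : Q 0ᶠ
      1∈         : Q 1ᶠ
      +-closed   : ∀ {x y} → Q x → Q y → Q (x ⊕ y)
      neg-closed : ∀ {x} → Q x → Q (⊝ x)
      *-closed   : ∀ {x y} → Q x → Q y → Q (x ⊗ y)
      inv-closed : ∀ {x y} → Q x → x ⊗ y ≡ 1ᶠ → Q y

  infixl 6 _-ˢ_
  infixl 7 _*ˢ_ _/ˢ_

  _-ˢ_ _*ˢ_ _/ˢ_ : Pred Carrier ℓ → Pred Carrier ℓ → Pred Carrier ℓ
  (X -ˢ Y) z = ∃[ x ] ∃[ y ] X x × Y y × z ≡ x ⊖ y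
  (X *ˢ Y) z = ∃[ x ] ∃[ y ] X x × Y y × z ≡ x ⊗ y
  -- In a field with y ≢ 0, the last equation says z = x / y.
  (X /ˢ Y) z = ∃[ x ] ∃[ y ] X x × Y y × y ≢ 0ᶠ × z ⊗ y ≡ x

  -- A subset of the field as a set of 1-tuples.
  ⌜_⌝ : Pred Carrier ℓ → Pred (Vec Carrier 1) ℓ
  ⌜ X ⌝ v = X (head v)

ExpandsFields : ∀ {ℓ} {L : Language ℓ} → RingSymbols L → Theory L → Set (lsuc ℓ)
ExpandsFields S T = ∀ M → M ⊨ T → FieldOps.IsField S M

module Submission where

{-
Write d = δ(Y), Δ = A - A and let A range over the definable supersets of Y that
are conjunctions of formulas of its type, chosen so that A and AA - A have
dimension barely above d.  Counting the fibres of addition (Ruzsa's triangle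
inequality) gives ∣X + yA∣ ≈ ∣X + A∣ for every definable X and every nonzero
y ∈ Y.  Let T be the set of popular differences of A, those with about d-many
representations a - b.  Regrouping x + y(a - b) + a′ = (x + ya) - (yb - a′) shows
that ∣X + yT + A∣ ≈ ∣X + A∣, so m ↦ mT is absorbed by A for every m in the ring
generated by Y.  Some translate of -T meets A in a set P of dimension about d.
If r = N / D with N and D in that ring, then DP + NP lies in a translate of
-DT - NT, so has dimension about d, and the map P × P → DP + NP has fibres of
dimension about d: there are about d-many z ∈ Δ with rz ∈ Δ, and r is a quotient
of differences of A.  By compactness r ∈ Q = (Y - Y) / (Y - Y), so Q is a field
containing Y.

Continuity of δ gives a definable E ⊇ Q all of whose elements r have about
d-many z ∈ Δ with rz ∈ Δ; since (r , z) ↦ (z , rz) is injective, ∣E∣ is about d.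
As Y + QY ⊆ Q ⊆ E, compactness yields one A such that A + rA ⊆ E for all
r ∈ (A - A) / (A - A).  Since ∣E∣ < 2d, (a , a′) ↦ a + ra′ is then injective on
no definable superset of Y, so r ∈ Q.  Hence Q = (A - A) / (A - A) is definable.

All estimates are made in natural multiples of a small rational unit ε, where
100 + e is the integral part of d / ε.
-}

open import Algebra.Bundles using (CommutativeRing)
import Algebra.Properties.Ring as RingProperties
import Algebra.Properties.Semiring.Mult as SemiringMult
import Algebra.Properties.Semiring.Mult.TCOptimised as SemiringMultOptimised
import Algebra.Solver.Ring
open import Algebra.Solver.Ring.AlmostCommutativeRing using (fromCommutativeRing; _-Raw-AlmostCommutative⟶_)
open import Data.Integer.Base as ℤ using (ℤ; +_; -[1+_])
import Data.Integer.Properties as ℤₚ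
open import Data.Maybe.Base as Maybe using ()
open import Data.Nat.Base as ℕ using (ℕ; zero; suc)
import Data.Nat.Properties as ℕₚ
open import Relation.Binary.PropositionalEquality as ≡ using (_≡_)
open import Relation.Nullary.Decidable using (yes; no; dec⇒maybe)

-- Ring identities with integer coefficients: unlike coefficients from an
-- abstract ring, these have decidable equality, so that terms cancel.
module IntegerSolver {c ℓ} (R : CommutativeRing c ℓ) where

  open CommutativeRing R
  open RingProperties ring
  open SemiringMultOptimised semiring using (1+×; ×-homo-+; ×1-homo-*) renaming (_×_ to _∙_)
  open import Relation.Binary.Reasoning.Setoid setoid

  ⟦_⟧ℤ : ℤ → Carrier
  ⟦ + n ⟧ℤ      = n ∙ 1#
  ⟦ -[1+ n ] ⟧ℤ = - (suc n ∙ 1#)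

  ⟦neg⟧ : ∀ i → ⟦ ℤ.- i ⟧ℤ ≈ - ⟦ i ⟧ℤ
  ⟦neg⟧ (+ zero)  = sym -0#≈0#
  ⟦neg⟧ (+ suc n) = refl
  ⟦neg⟧ -[1+ n ]  = sym (-‿involutive _)

  ⟦⊖⟧ : ∀ m n → ⟦ m ℤ.⊖ n ⟧ℤ ≈ m ∙ 1# - n ∙ 1#
  ⟦⊖⟧ m zero = sym (trans (+-congˡ -0#≈0#) (+-identityʳ _))
  ⟦⊖⟧ zero (suc n) = sym (+-identityˡ _)
  ⟦⊖⟧ (suc m) (suc n) = begin
    ⟦ suc m ℤ.⊖ suc n ⟧ℤ              ≡⟨ ≡.cong ⟦_⟧ℤ (ℤₚ.[1+m]⊖[1+n]≡m⊖n m n) ⟩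
    ⟦ m ℤ.⊖ n ⟧ℤ                      ≈⟨ ⟦⊖⟧ m n ⟩
    x - y                             ≈⟨ +-congʳ (+-identityˡ x) ⟨
    (0# + x) - y                      ≈⟨ +-congʳ (+-congʳ (-‿inverseʳ 1#)) ⟨
    (1# - 1# + x) - y                 ≈⟨ +-congʳ (+-assoc 1# (- 1#) x) ⟩
    (1# + (- 1# + x)) - y             ≈⟨ +-congʳ (+-congˡ (+-comm (- 1#) x)) ⟩
    (1# + (x - 1#)) - y               ≈⟨ +-congʳ (+-assoc 1# x (- 1#)) ⟨
    ((1# + x) - 1#) - y               ≈⟨ +-assoc (1# + x) (- 1#) (- y) ⟩
    (1# + x) + (- 1# - y)             ≈⟨ +-congˡ (-‿+-comm 1# y) ⟩
    (1# + x) - (1# + y)               ≈⟨ +-cong (1+× m 1#) (-‿cong (1+× n 1#)) ⟨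
    suc m ∙ 1# - suc n ∙ 1#           ∎
    where
    x = m ∙ 1#
    y = n ∙ 1#

  ⟦+⟧ : ∀ i j → ⟦ i ℤ.+ j ⟧ℤ ≈ ⟦ i ⟧ℤ + ⟦ j ⟧ℤ
  ⟦+⟧ (+ m)    (+ n)    = ×-homo-+ 1# m n
  ⟦+⟧ (+ m)    -[1+ n ] = ⟦⊖⟧ m (suc n)
  ⟦+⟧ -[1+ m ] (+ n)    = trans (⟦⊖⟧ n (suc m)) (+-comm _ _)
  ⟦+⟧ -[1+ m ] -[1+ n ] = begin
    - (suc (suc (m ℕ.+ n)) ∙ 1#)       ≡⟨ ≡.cong (λ k → - (suc k ∙ 1#)) (ℕₚ.+-suc m n) ⟨
    - ((suc m ℕ.+ suc n) ∙ 1#)         ≈⟨ -‿cong (×-homo-+ 1# (suc m) (suc n)) ⟩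
    - (suc m ∙ 1# + suc n ∙ 1#)        ≈⟨ -‿+-comm _ _ ⟨
    - (suc m ∙ 1#) - suc n ∙ 1#        ∎

  ⟦+*+⟧ : ∀ m n → ⟦ + m ℤ.* + n ⟧ℤ ≈ ⟦ + m ⟧ℤ * ⟦ + n ⟧ℤ
  ⟦+*+⟧ m n = trans (reflexive (≡.cong ⟦_⟧ℤ (≡.sym (ℤₚ.pos-* m n)))) (×1-homo-* m n)

  ⟦+*⟧ : ∀ m j → ⟦ + m ℤ.* j ⟧ℤ ≈ ⟦ + m ⟧ℤ * ⟦ j ⟧ℤ
  ⟦+*⟧ m (+ n)    = ⟦+*+⟧ m n
  ⟦+*⟧ m -[1+ n ] = begin
    ⟦ + m ℤ.* -[1+ n ] ⟧ℤ            ≡⟨ ≡.cong ⟦_⟧ℤ (ℤₚ.neg-distribʳ-* (+ m) (+ suc n)) ⟨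
    ⟦ ℤ.- (+ m ℤ.* + suc n) ⟧ℤ       ≈⟨ ⟦neg⟧ (+ m ℤ.* + suc n) ⟩
    - ⟦ + m ℤ.* + suc n ⟧ℤ           ≈⟨ -‿cong (⟦+*+⟧ m (suc n)) ⟩
    - (⟦ + m ⟧ℤ * ⟦ + suc n ⟧ℤ)      ≈⟨ -‿distribʳ-* _ _ ⟩
    ⟦ + m ⟧ℤ * ⟦ -[1+ n ] ⟧ℤ         ∎

  ⟦*⟧ : ∀ i j → ⟦ i ℤ.* j ⟧ℤ ≈ ⟦ i ⟧ℤ * ⟦ j ⟧ℤ
  ⟦*⟧ (+ m)    j = ⟦+*⟧ m j
  ⟦*⟧ -[1+ m ] j = begin
    ⟦ -[1+ m ] ℤ.* j ⟧ℤ              ≡⟨ ≡.cong ⟦_⟧ℤ (ℤₚ.neg-distribˡ-* (+ suc m) j) ⟨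
    ⟦ ℤ.- (+ suc m ℤ.* j) ⟧ℤ         ≈⟨ ⟦neg⟧ (+ suc m ℤ.* j) ⟩
    - ⟦ + suc m ℤ.* j ⟧ℤ             ≈⟨ -‿cong (⟦+*⟧ (suc m) j) ⟩
    - (⟦ + suc m ⟧ℤ * ⟦ j ⟧ℤ)        ≈⟨ -‿distribˡ-* _ _ ⟩
    ⟦ -[1+ m ] ⟧ℤ * ⟦ j ⟧ℤ           ∎

  morphism : ℤ.+-*-rawRing -Raw-AlmostCommutative⟶ fromCommutativeRing R
  morphism = record
    { ⟦_⟧    = ⟦_⟧ℤ
    ; +-homo = ⟦+⟧
    ; *-homo = ⟦*⟧
    ; -‿homo = ⟦neg⟧
    ; 0-homo = refl
    ; 1-homo = refl
    }

  open Algebra.Solver.Ring ℤ.+-*-rawRing (fromCommutativeRing R) morphism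
    (λ i j → Maybe.map (λ i≡j → reflexive (≡.cong ⟦_⟧ℤ i≡j)) (dec⇒maybe (i ℤₚ.≟ j))) public
    using (Polynomial; solve; _:=_; _:+_; _:*_; _:-_; :-_)
    renaming (con to int)

  𝟙 -𝟙 : ∀ {n} → Polynomial n
  𝟙  = int (+ 1)
  -𝟙 = :- 𝟙

open import Defs
open import Level using (Level; Lift; lift; lower)
open import Axiom.DoubleNegationElimination using (em⇒dne)
open import Axiom.ExcludedMiddle using (ExcludedMiddle)
open import Data.Empty using (⊥-elim)
open import Data.Fin.Base as Fin using (Fin; zero; suc; toℕ; splitAt; _↑ˡ_; _↑ʳ_)
open import Data.List.Base as List using (List)
open import Data.List.Relation.Unary.All using (All; []; _∷_)
open import Data.List.Relation.Unary.Any using (here)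
open import Data.Product.Base using (Σ; Σ-syntax; ∃-syntax; _×_; _,_; proj₁; proj₂)
open import Data.Rational.Base as ℚ using (ℚ; 0ℚ; 1ℚ; ↥_; ↧_; toℚᵘ)
import Data.Rational.Properties as ℚₚ
open import Data.Rational.Solver using () renaming (module +-*-Solver to ℚ-Solver)
import Data.Rational.Unnormalised.Base as ℚᵘ
import Data.Rational.Unnormalised.Properties as ℚᵘₚ
open import Data.Sum.Base as Sum using (_⊎_; inj₁; inj₂; [_,_]′)
open import Data.Vec.Base as Vec using (Vec; []; _∷_; _++_; lookup; map; take; drop; tabulate)
open import Data.Vec.Properties using (lookup-map; lookup-++ˡ; lookup-++ʳ; lookup-splitAt; map-id; map-∘; map-cong; tabulate-∘; tabulate-cong; tabulate∘lookup; ∷-injective; ∷-injectiveˡ; take++drop≡id)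
open import Function.Base using (id; _∘_)
open import Function.Bundles using (_↣_; _⇔_; mk⇔; Injection; Equivalence)
open import Relation.Binary.PropositionalEquality using (_≢_; refl; sym; trans; cong; cong₂; subst; module ≡-Reasoning)
open import Relation.Nullary.Negation using (¬_)
open import Relation.Unary using (Pred; _⊆_; _≐_; Satisfiable)

-- Multiples of a rational unit in [0,∞]

private module ℚM = SemiringMult (CommutativeRing.semiring ℚₚ.+-*-commutativeRing)
open ℚM using () renaming (_×_ to _∙_; ×-homo-+ to ∙-homo-+)

private variable ℓ : Level

toℚᵘ-∙1 : ∀ n → toℚᵘ (n ∙ 1ℚ) ℚᵘ.≃ ℚᵘ.mkℚᵘ (ℤ.+ n) 0
toℚᵘ-∙1 zero    = ℚᵘₚ.≃-refl
toℚᵘ-∙1 (suc n) = ℚᵘₚ.≃-trans (ℚₚ.toℚᵘ-homo-+ 1ℚ (n ∙ 1ℚ))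
  (ℚᵘₚ.≃-trans (ℚᵘₚ.+-congʳ (toℚᵘ 1ℚ) (toℚᵘ-∙1 n)) (ℚᵘ.*≡* eq))
  where
  eq : (ℤ.+ 1 ℤ.* ℤ.+ 1 ℤ.+ ℤ.+ n ℤ.* ℤ.+ 1) ℤ.* ℤ.+ 1 ≡ ℤ.+ suc n ℤ.* ℤ.+ 1
  eq = cong (λ i → (ℤ.+ 1 ℤ.+ i) ℤ.* ℤ.+ 1) (ℤₚ.*-identityʳ (ℤ.+ n))

-- The denominator is a positive natural number, so dividing by it does not increase the absolute
-- value.
q≤∣↥q∣ : ∀ q → q ℚ.≤ ℤ.∣ ↥ q ∣ ∙ 1ℚ
q≤∣↥q∣ q@record{} = ℚₚ.toℚᵘ-cancel-≤
  (ℚᵘₚ.≤-respʳ-≃ (ℚᵘₚ.≃-sym (toℚᵘ-∙1 ℤ.∣ ↥ q ∣)) (ℚᵘ.*≤* le))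
  where
  le : ↥ q ℤ.* ℤ.+ 1 ℤ.≤ ℤ.+ ℤ.∣ ↥ q ∣ ℤ.* ↧ q
  le = ℤₚ.≤-trans (ℤₚ.≤-reflexive (ℤₚ.*-identityʳ (↥ q)))
    (ℤₚ.≤-trans (bound (↥ q)) (ℤₚ.≤-trans
      (ℤ.+≤+ (ℕₚ.m≤m*n ℤ.∣ ↥ q ∣ (ℚ.↧ₙ q))) (ℤₚ.≤-reflexive (ℤₚ.pos-* ℤ.∣ ↥ q ∣ (ℚ.↧ₙ q)))))
    where
    bound : ∀ i → i ℤ.≤ ℤ.+ ℤ.∣ i ∣
    bound (ℤ.+ n)    = ℤₚ.≤-refl
    bound ℤ.-[1+ n ] = ℤ.-≤+

p<q⇒0<q-p : ∀ {p q} → p ℚ.< q → 0ℚ ℚ.< q ℚ.- p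
p<q⇒0<q-p {p} {q} p<q = subst (ℚ._< q ℚ.- p) (ℚₚ.+-inverseʳ p) (ℚₚ.+-monoˡ-< (ℚ.- p) p<q)

archimedean : ∀ {ε} → 0ℚ ℚ.< ε → ∀ q → ∃[ n ] q ℚ.≤ n ∙ ε
archimedean {ε} 0<ε q = n , (begin
  q                        ≡⟨ ℚₚ.*-identityʳ q ⟨
  q ℚ.* 1ℚ                 ≡⟨ cong (q ℚ.*_) (ℚₚ.*-inverseˡ ε) ⟨
  q ℚ.* (ℚ.1/ ε ℚ.* ε)     ≡⟨ ℚₚ.*-assoc q (ℚ.1/ ε) ε ⟨
  r ℚ.* ε                  ≤⟨ ℚₚ.*-monoʳ-≤-nonNeg ε (q≤∣↥q∣ r) ⟩
  (n ∙ 1ℚ) ℚ.* ε           ≡⟨ ℚM.×-assoc-* n 1ℚ ε ⟩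
  n ∙ (1ℚ ℚ.* ε)           ≡⟨ cong (n ∙_) (ℚₚ.*-identityˡ ε) ⟩
  n ∙ ε                    ∎)
  where
  open ℚₚ.≤-Reasoning
  instance
    ε>0 : ℚ.Positive ε
    ε>0 = ℚ.positive 0<ε
    ε≢0 : ℚ.NonZero ε
    ε≢0 = ℚₚ.pos⇒nonZero ε
    ε≥0 : ℚ.NonNegative ε
    ε≥0 = ℚₚ.pos⇒nonNeg ε
  r = q ℚ.* ℚ.1/ ε
  n = ℤ.∣ ↥ r ∣

module _ {ε : ℚ} (0<ε : 0ℚ ℚ.< ε) where

  ∙-pos : ∀ n → 0ℚ ℚ.< suc n ∙ ε
  ∙-nonNeg : ∀ n → 0ℚ ℚ.≤ n ∙ ε

  ∙-nonNeg zero    = ℚₚ.≤-refl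
  ∙-nonNeg (suc n) = ℚₚ.<⇒≤ (∙-pos n)

  ∙-pos n = ℚₚ.<-≤-trans 0<ε
    (subst (ℚ._≤ suc n ∙ ε) (ℚₚ.+-identityʳ ε) (ℚₚ.+-monoʳ-≤ ε (∙-nonNeg n)))

  ∙-mono : ∀ {m n} → m ℕ.≤ n → m ∙ ε ℚ.≤ n ∙ ε
  ∙-mono {n = n} ℕ.z≤n = ∙-nonNeg n
  ∙-mono (ℕ.s≤s m≤n)   = ℚₚ.+-monoʳ-≤ ε (∙-mono m≤n)

  ∙-strict : ∀ n → n ∙ ε ℚ.< suc n ∙ ε
  ∙-strict n = subst (ℚ._< suc n ∙ ε) (ℚₚ.+-identityˡ (n ∙ ε)) (ℚₚ.+-monoˡ-< (n ∙ ε) 0<ε)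

  ∙-cancel-< : ∀ {m n} → m ∙ ε ℚ.< n ∙ ε → m ℕ.< n
  ∙-cancel-< p = ℕₚ.≰⇒> λ n≤m → ℚₚ.<-irrefl refl (ℚₚ.<-≤-trans p (∙-mono n≤m))

-- The argument bounds `E` only up to 80 units above d and wants d to have at least 100 units; a
-- hundredth of η serves both purposes.
small-unit : ∀ {η} → 0ℚ ℚ.< η → ∃[ ε ] 0ℚ ℚ.< ε × 100 ∙ ε ℚ.≤ η
small-unit {η} 0<η = η ℚ.* c , pos , (begin
  100 ∙ (η ℚ.* c)   ≡⟨ ℚM.×-comm-* 100 η c ⟨
  η ℚ.* (100 ∙ c)   ≡⟨⟩
  η ℚ.* 1ℚ          ≡⟨ ℚₚ.*-identityʳ η ⟩
  η                 ∎)
  where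
  open ℚₚ.≤-Reasoning
  c = ℤ.+ 1 ℚ./ 100
  instance
    η>0 : ℚ.Positive η
    η>0 = ℚ.positive 0<η
  pos : 0ℚ ℚ.< η ℚ.* c
  pos = ℚₚ.positive⁻¹ (η ℚ.* c) {{ℚₚ.pos*pos⇒pos η c}}

module Units {ε : ℚ} (0<ε : 0ℚ ℚ.< ε) where

  infix 4 _≺_
  _≺_ : ℝ≥0∞ ℓ → ℕ → Set ℓ
  x ≺ n = cut x (n ∙ ε)

  ≺-mono : ∀ (x : ℝ≥0∞ ℓ) {m n} → m ℕ.≤ n → x ≺ m → x ≺ n
  ≺-mono x m≤n x≺m = upper x x≺m (∙-mono 0<ε m≤n)

  ≺⇒pos : ∀ (x : ℝ≥0∞ ℓ) {n} → x ≺ n → 0 ℕ.< n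
  ≺⇒pos x x≺n = ∙-cancel-< 0<ε (positive x x≺n)

  0∞≺ : ∀ {n} → 0 ℕ.< n → 0∞ {ℓ} ≺ n
  0∞≺ {n = suc n} _ = lift (∙-pos 0<ε n)

  +-≺ : ∀ (x y : ℝ≥0∞ ℓ) {m n} → x ≺ m → y ≺ n → x + y ≺ m ℕ.+ n
  +-≺ x y {m} {n} x≺m y≺n =
    m ∙ ε , n ∙ ε , x≺m , y≺n , ℚₚ.≤-reflexive (sym (ℚM.×-homo-+ ε m n))

  -- In a rational bound p + q for x + y, the part q exceeds n units because y has at least that
  -- many; less than m units remain for p.
  +-≺⁻ : ∀ (x y : ℝ≥0∞ ℓ) {m n} → x + y ≺ m ℕ.+ n → ¬ y ≺ n → x ≺ m
  +-≺⁻ x y {m} {n} (p , q , xp , yq , p+q≤) y⊀n = upper x xp (ℚₚ.≮⇒≥ λ m<p →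
    ℚₚ.<-irrefl refl (ℚₚ.<-≤-trans
      (ℚₚ.+-mono-< m<p (ℚₚ.≰⇒> λ q≤n → y⊀n (upper y yq q≤n)))
      (subst (p ℚ.+ q ℚ.≤_) (ℚM.×-homo-+ ε m n) p+q≤)))

  -- The supremum of values below n units may equal n units. Roundedness of the cut of x leaves a
  -- gap below m units, which absorbs this.
  +-sup-≺ : ∀ (x : ℝ≥0∞ ℓ) {I : Set ℓ} (y : I → ℝ≥0∞ ℓ) {m n} →
            x ≺ m → 0 ℕ.< n → (∀ i → y i ≺ n) → x + sup y ≺ m ℕ.+ n
  +-sup-≺ x y {m} {n@(suc n-1)} x≺m _ y≺n with rounded x x≺m
  ... | p , p<m , xp =
    p , n ∙ ε ℚ.+ (m ∙ ε ℚ.- p) , xp , (n ∙ ε , ∙-pos 0<ε n-1 , n< , y≺n) , ℚₚ.≤-reflexive eq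
    where
    open ≡-Reasoning
    n< : n ∙ ε ℚ.< n ∙ ε ℚ.+ (m ∙ ε ℚ.- p)
    n< = subst (ℚ._< n ∙ ε ℚ.+ (m ∙ ε ℚ.- p)) (ℚₚ.+-identityʳ (n ∙ ε))
      (ℚₚ.+-monoʳ-< (n ∙ ε) (p<q⇒0<q-p p<m))
    eq : p ℚ.+ (n ∙ ε ℚ.+ (m ∙ ε ℚ.- p)) ≡ (m ℕ.+ n) ∙ ε
    eq = trans (ℚ-Solver.solve 3 (λ p n m → p ℚ-Solver.:+ (n ℚ-Solver.:+ (m ℚ-Solver.:- p)) ℚ-Solver.:= m ℚ-Solver.:+ n) refl p (n ∙ ε) (m ∙ ε))
      (sym (ℚM.×-homo-+ ε m n))

fromℚ : ℚ → ℝ≥0∞ ℓ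
fromℚ r .cut q = Lift _ (0ℚ ℚ.< q × r ℚ.< q)
fromℚ r .positive (lift (0<q , _)) = 0<q
fromℚ r .upper (lift (0<p , r<p)) p≤q = lift (ℚₚ.<-≤-trans 0<p p≤q , ℚₚ.<-≤-trans r<p p≤q)
fromℚ r .rounded {q} (lift (0<q , r<q)) with ℚₚ.<-dense 0<q | ℚₚ.<-dense r<q
... | p , 0<p , p<q | p′ , r<p′ , p′<q with ℚₚ.≤-total p p′
... | inj₁ p≤p′ = p′ , p′<q , lift (ℚₚ.<-≤-trans 0<p p≤p′ , r<p′)
... | inj₂ p′≤p = p , p<q , lift (0<p , ℚₚ.<-≤-trans r<p′ p′≤p)

common-lower-bound : ∀ {p q} → 0ℚ ℚ.< p → 0ℚ ℚ.< q → ∃[ r ] 0ℚ ℚ.< r × r ℚ.≤ p × r ℚ.≤ q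
common-lower-bound {p} {q} 0<p 0<q with ℚₚ.≤-total p q
... | inj₁ p≤q = p , 0<p , ℚₚ.≤-refl , p≤q
... | inj₂ q≤p = q , 0<q , q≤p , ℚₚ.≤-refl

-- Definable sets

to : ∀ {a b} {A : Set a} {B : Set b} → A ⇔ B → A → B
to = Equivalence.to

from : ∀ {a b} {A : Set a} {B : Set b} → A ⇔ B → B → A
from = Equivalence.from

module _ {ℓ} {L : Language ℓ} where

  renᵗ  : ∀ {n m} → (Fin n → Fin m) → Term L n → Term L m
  renᵗˢ : ∀ {n m k} → (Fin n → Fin m) → Vec (Term L n) k → Vec (Term L m) k
  renᵗ ρ (var i)    = var (ρ i)
  renᵗ ρ (fun f ts) = fun f (renᵗˢ ρ ts)
  renᵗˢ ρ []       = []
  renᵗˢ ρ (t ∷ ts) = renᵗ ρ t ∷ renᵗˢ ρ ts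

  subᵗ  : ∀ {n m} → (Fin n → Term L m) → Term L n → Term L m
  subᵗˢ : ∀ {n m k} → (Fin n → Term L m) → Vec (Term L n) k → Vec (Term L m) k
  subᵗ σ (var i)    = σ i
  subᵗ σ (fun f ts) = fun f (subᵗˢ σ ts)
  subᵗˢ σ []       = []
  subᵗˢ σ (t ∷ ts) = subᵗ σ t ∷ subᵗˢ σ ts

  lift-sub : ∀ {n m} → (Fin n → Term L m) → Fin (suc n) → Term L (suc m)
  lift-sub σ zero    = var zero
  lift-sub σ (suc i) = renᵗ suc (σ i)

  sub : ∀ {n m} → (Fin n → Term L m) → Formula L n → Formula L m
  sub σ (s ≐̇ t)    = subᵗ σ s ≐̇ subᵗ σ t
  sub σ (rel R ts) = rel R (subᵗˢ σ ts)
  sub σ ⊥̇          = ⊥̇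
  sub σ (φ ∧̇ ψ)    = sub σ φ ∧̇ sub σ ψ
  sub σ (φ ∨̇ ψ)    = sub σ φ ∨̇ sub σ ψ
  sub σ (φ ⇒̇ ψ)    = sub σ φ ⇒̇ sub σ ψ
  sub σ (∃̇ φ)      = ∃̇ (sub (lift-sub σ) φ)
  sub σ (∀̇ φ)      = ∀̇ (sub (lift-sub σ) φ)

  module _ (M : Structure L) where
    open Structure M

    eval-ren  : ∀ {n m} (ρ : Fin n → Fin m) {v w} → (∀ i → lookup w (ρ i) ≡ lookup v i) →
                ∀ t → eval M (renᵗ ρ t) w ≡ eval M t v
    evals-ren : ∀ {n m k} (ρ : Fin n → Fin m) {v w} → (∀ i → lookup w (ρ i) ≡ lookup v i) →
                ∀ (ts : Vec _ k) → evals M (renᵗˢ ρ ts) w ≡ evals M ts v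
    eval-ren ρ h (var i)    = h i
    eval-ren ρ h (fun f ts) = cong ⟦ f ⟧ᶠ (evals-ren ρ h ts)
    evals-ren ρ h []       = refl
    evals-ren ρ h (t ∷ ts) = cong₂ _∷_ (eval-ren ρ h t) (evals-ren ρ h ts)

    eval-sub  : ∀ {n m} (σ : Fin n → Term L m) {v w} → (∀ i → eval M (σ i) w ≡ lookup v i) →
                ∀ t → eval M (subᵗ σ t) w ≡ eval M t v
    evals-sub : ∀ {n m k} (σ : Fin n → Term L m) {v w} → (∀ i → eval M (σ i) w ≡ lookup v i) →
                ∀ (ts : Vec _ k) → evals M (subᵗˢ σ ts) w ≡ evals M ts v
    eval-sub σ h (var i)    = h i
    eval-sub σ h (fun f ts) = cong ⟦ f ⟧ᶠ (evals-sub σ h ts)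
    evals-sub σ h []       = refl
    evals-sub σ h (t ∷ ts) = cong₂ _∷_ (eval-sub σ h t) (evals-sub σ h ts)

    eval-lift-sub : ∀ {n m} (σ : Fin n → Term L m) {v w} x → (∀ i → eval M (σ i) w ≡ lookup v i) →
                    ∀ i → eval M (lift-sub σ i) (x ∷ w) ≡ lookup (x ∷ v) i
    eval-lift-sub σ x h zero    = refl
    eval-lift-sub σ x h (suc i) = trans (eval-ren suc (λ _ → refl) (σ i)) (h i)

    Sat-sub : ∀ {n m} (σ : Fin n → Term L m) {v w} → (∀ i → eval M (σ i) w ≡ lookup v i) →
              ∀ φ → Sat M (sub σ φ) w ⇔ Sat M φ v
    Sat-sub σ h (s ≐̇ t) = mk⇔
      (λ e → trans (sym (eval-sub σ h s)) (trans e (eval-sub σ h t)))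
      (λ e → trans (eval-sub σ h s) (trans e (sym (eval-sub σ h t))))
    Sat-sub σ h (rel R ts) = mk⇔ (subst ⟦ R ⟧ʳ (evals-sub σ h ts)) (subst ⟦ R ⟧ʳ (sym (evals-sub σ h ts)))
    Sat-sub σ h ⊥̇ = mk⇔ id id
    Sat-sub σ h (φ ∧̇ ψ) = mk⇔
      (λ (a , b) → to (Sat-sub σ h φ) a , to (Sat-sub σ h ψ) b)
      (λ (a , b) → from (Sat-sub σ h φ) a , from (Sat-sub σ h ψ) b)
    Sat-sub σ h (φ ∨̇ ψ) = mk⇔
      (Sum.map (to (Sat-sub σ h φ)) (to (Sat-sub σ h ψ)))
      (Sum.map (from (Sat-sub σ h φ)) (from (Sat-sub σ h ψ)))
    Sat-sub σ h (φ ⇒̇ ψ) = mk⇔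
      (λ f a → to (Sat-sub σ h ψ) (f (from (Sat-sub σ h φ) a)))
      (λ f a → from (Sat-sub σ h ψ) (f (to (Sat-sub σ h φ) a)))
    Sat-sub σ h (∃̇ φ) = mk⇔
      (λ (x , a) → x , to (Sat-sub (lift-sub σ) (eval-lift-sub σ x h) φ) a)
      (λ (x , a) → x , from (Sat-sub (lift-sub σ) (eval-lift-sub σ x h) φ) a)
    Sat-sub σ h (∀̇ φ) = mk⇔
      (λ f x → to (Sat-sub (lift-sub σ) (eval-lift-sub σ x h) φ) (f x))
      (λ f x → from (Sat-sub (lift-sub σ) (eval-lift-sub σ x h) φ) (f x))

-- A syntax for definable sets with parameters in which formulas can be
-- substituted into, so that closure properties come for free.
module DefinableSets {ℓ} {L : Language ℓ} (S : RingSymbols L) (F : Structure L)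
  {C : Set ℓ} (⟦_⟧ᶜ : C → Structure.Carrier F) where

  open Structure F
  open RingSymbols S
  open FieldOps S F

  infixl 7 _+ᵗ_ _-ᵗ_
  infixl 8 _*ᵗ_
  infix  9 -ᵗ_
  data Tm (n : ℕ) : Set ℓ where
    var       : Fin n → Tm n
    con       : C → Tm n
    _+ᵗ_ _*ᵗ_ : Tm n → Tm n → Tm n
    -ᵗ_       : Tm n → Tm n

  _-ᵗ_ : ∀ {n} → Tm n → Tm n → Tm n
  s -ᵗ t = s +ᵗ (-ᵗ t)

  ⟦_⟧ₜ : ∀ {n} → Tm n → Vec Carrier n → Carrier
  ⟦ var i ⟧ₜ v  = lookup v i
  ⟦ con c ⟧ₜ v  = ⟦ c ⟧ᶜ
  ⟦ s +ᵗ t ⟧ₜ v = ⟦ s ⟧ₜ v ⊕ ⟦ t ⟧ₜ v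
  ⟦ s *ᵗ t ⟧ₜ v = ⟦ s ⟧ₜ v ⊗ ⟦ t ⟧ₜ v
  ⟦ -ᵗ t ⟧ₜ v   = ⊝ ⟦ t ⟧ₜ v

  ⟦_⟧* : ∀ {n m} → Vec (Tm n) m → Vec Carrier n → Vec Carrier m
  ⟦ [] ⟧* v     = []
  ⟦ t ∷ ts ⟧* v = ⟦ t ⟧ₜ v ∷ ⟦ ts ⟧* v

  infix  6 _==_
  infixr 5 _∧_
  infixr 5 _∨_
  infix  8 _[_]
  data Fm : ℕ → Set ℓ where
    base    : ∀ {n} → FormulaOver L C n → Fm n
    _[_]    : ∀ {n m} → Fm m → Vec (Tm n) m → Fm n
    _==_    : ∀ {n} → Tm n → Tm n → Fm n
    _∧_ _∨_ : ∀ {n} → Fm n → Fm n → Fm n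
    neg     : ∀ {n} → Fm n → Fm n
    ex      : ∀ {n} → Fm (suc n) → Fm n

  ⟦_⟧ : ∀ {n} → Fm n → Pred (Vec Carrier n) ℓ
  ⟦ base ψ ⟧   v = SatOver F ⟦_⟧ᶜ ψ v
  ⟦ φ [ ts ] ⟧ v = ⟦ φ ⟧ (⟦ ts ⟧* v)
  ⟦ s == t ⟧   v = ⟦ s ⟧ₜ v ≡ ⟦ t ⟧ₜ v
  ⟦ φ ∧ ψ ⟧    v = ⟦ φ ⟧ v × ⟦ ψ ⟧ v
  ⟦ φ ∨ ψ ⟧    v = ⟦ φ ⟧ v ⊎ ⟦ ψ ⟧ v
  ⟦ neg φ ⟧    v = ¬ ⟦ φ ⟧ v
  ⟦ ex φ ⟧     v = ∃[ x ] ⟦ φ ⟧ (x ∷ v)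

  private
    -- Two formulas or terms to be combined carry separate parameter blocks. In the common
    -- environment the variables come first, then the left block, then the right one; `wkˡ` and
    -- `wkʳ` send each side to its own block.
    wkˡ : ∀ n {k k′} → Fin (n ℕ.+ k) → Fin (n ℕ.+ (k ℕ.+ k′))
    wkˡ n {k} {k′} i = [ _↑ˡ (k ℕ.+ k′) , (λ j → n ↑ʳ (j ↑ˡ k′)) ]′ (splitAt n i)

    wkʳ : ∀ n {k k′} → Fin (n ℕ.+ k′) → Fin (n ℕ.+ (k ℕ.+ k′))
    wkʳ n {k} {k′} i = [ _↑ˡ (k ℕ.+ k′) , (λ j → n ↑ʳ (k ↑ʳ j)) ]′ (splitAt n i)

    module _ {n k k′} (v : Vec Carrier n) (b : Vec C k) (b′ : Vec C k′) where

      env : Vec Carrier (n ℕ.+ (k ℕ.+ k′))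
      env = v ++ map ⟦_⟧ᶜ (b ++ b′)

      lookup-b : ∀ j → lookup env (n ↑ʳ (j ↑ˡ k′)) ≡ lookup (map ⟦_⟧ᶜ b) j
      lookup-b j = trans (lookup-++ʳ v _ (j ↑ˡ k′)) (trans (lookup-map (j ↑ˡ k′) ⟦_⟧ᶜ (b ++ b′))
        (trans (cong ⟦_⟧ᶜ (lookup-++ˡ b b′ j)) (sym (lookup-map j ⟦_⟧ᶜ b))))

      lookup-b′ : ∀ j → lookup env (n ↑ʳ (k ↑ʳ j)) ≡ lookup (map ⟦_⟧ᶜ b′) j
      lookup-b′ j = trans (lookup-++ʳ v _ (k ↑ʳ j)) (trans (lookup-map (k ↑ʳ j) ⟦_⟧ᶜ (b ++ b′))
        (trans (cong ⟦_⟧ᶜ (lookup-++ʳ b b′ j)) (sym (lookup-map j ⟦_⟧ᶜ b′))))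

      lookup-wkˡ : ∀ i → lookup env (wkˡ n i) ≡ lookup (v ++ map ⟦_⟧ᶜ b) i
      lookup-wkˡ i = trans (h (splitAt n i)) (sym (lookup-splitAt n v (map ⟦_⟧ᶜ b) i))
        where
        h : ∀ s → lookup env ([ _↑ˡ (k ℕ.+ k′) , (λ j → n ↑ʳ (j ↑ˡ k′)) ]′ s)
            ≡ [ lookup v , lookup (map ⟦_⟧ᶜ b) ]′ s
        h (inj₁ i) = lookup-++ˡ v _ i
        h (inj₂ j) = lookup-b j

      lookup-wkʳ : ∀ i → lookup env (wkʳ n i) ≡ lookup (v ++ map ⟦_⟧ᶜ b′) i
      lookup-wkʳ i = trans (h (splitAt n i)) (sym (lookup-splitAt n v (map ⟦_⟧ᶜ b′) i))
        where
        h : ∀ s → lookup env ([ _↑ˡ (k ℕ.+ k′) , (λ j → n ↑ʳ (k ↑ʳ j)) ]′ s)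
            ≡ [ lookup v , lookup (map ⟦_⟧ᶜ b′) ]′ s
        h (inj₁ i) = lookup-++ˡ v _ i
        h (inj₂ j) = lookup-b′ j

  TermsOver : ℕ → ℕ → Set ℓ
  TermsOver n m = Σ[ k ∈ ℕ ] Vec (Term L (n ℕ.+ k)) m × Vec C k

  _evaluates_ : ∀ {n m} → TermsOver n m → (Vec Carrier n → Vec Carrier m) → Set ℓ
  (k , ts , b) evaluates f = ∀ v → evals F ts (v ++ map ⟦_⟧ᶜ b) ≡ f v

  private
    _⊙_ : ∀ {n m m′} → TermsOver n m → TermsOver n m′ → TermsOver n (m ℕ.+ m′)
    _⊙_ {n} (k , ts , b) (k′ , ts′ , b′) =
      k ℕ.+ k′ , renᵗˢ (wkˡ n) ts ++ renᵗˢ (wkʳ n) ts′ , b ++ b′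

    evals-++ : ∀ {n m m′} (ts : Vec (Term L n) m) (ts′ : Vec (Term L n) m′) v →
               evals F (ts ++ ts′) v ≡ evals F ts v ++ evals F ts′ v
    evals-++ []       ts′ v = refl
    evals-++ (t ∷ ts) ts′ v = cong (eval F t v ∷_) (evals-++ ts ts′ v)

    ⊙-evaluates : ∀ {n m m′} {f : Vec Carrier n → Vec Carrier m} {f′ : Vec Carrier n → Vec Carrier m′}
      (t : TermsOver n m) (t′ : TermsOver n m′) → t evaluates f → t′ evaluates f′ →
      (t ⊙ t′) evaluates (λ v → f v ++ f′ v)
    ⊙-evaluates {n} (k , ts , b) (k′ , ts′ , b′) h h′ v =
      trans (evals-++ (renᵗˢ (wkˡ n) ts) _ _)
        (cong₂ _++_ (trans (evals-ren F (wkˡ n) (lookup-wkˡ v b b′) ts) (h v))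
                    (trans (evals-ren F (wkʳ n) (lookup-wkʳ v b b′) ts′) (h′ v)))

    apply : ∀ {n m} → Language.Func L m → TermsOver n m → TermsOver n 1
    apply f (k , ts , b) = k , fun f ts ∷ [] , b

    termOver : ∀ {n} (t : Tm n) → Σ[ u ∈ TermsOver n 1 ] u evaluates (λ v → ⟦ t ⟧ₜ v ∷ [])
    termOver (var i) = (0 , var (i ↑ˡ 0) ∷ [] , []) , λ v → cong (_∷ []) (lookup-++ˡ v [] i)
    termOver {n} (con c) = (1 , var (n ↑ʳ zero) ∷ [] , c ∷ []) ,
      λ v → cong (_∷ []) (lookup-++ʳ v (⟦ c ⟧ᶜ ∷ []) zero)
    termOver (s +ᵗ t) with termOver s | termOver t
    ... | u , hu | w , hw = apply plusˢ (u ⊙ w) ,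
      λ v → cong (λ xs → ⟦ plusˢ ⟧ᶠ xs ∷ []) (⊙-evaluates u w hu hw v)
    termOver (s *ᵗ t) with termOver s | termOver t
    ... | u , hu | w , hw = apply mulˢ (u ⊙ w) ,
      λ v → cong (λ xs → ⟦ mulˢ ⟧ᶠ xs ∷ []) (⊙-evaluates u w hu hw v)
    termOver (-ᵗ t) with termOver t
    ... | u , hu = apply negˢ u , λ v → cong (λ xs → ⟦ negˢ ⟧ᶠ xs ∷ []) (hu v)

    termsOver : ∀ {n m} (ts : Vec (Tm n) m) → Σ[ u ∈ TermsOver n m ] u evaluates ⟦ ts ⟧*
    termsOver [] = (0 , [] , []) , λ v → refl
    termsOver (t ∷ ts) with termOver t | termsOver ts
    ... | u , hu | w , hw = u ⊙ w , ⊙-evaluates u w hu hw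

    lookup-evals : ∀ {n m} (ts : Vec (Term L n) m) v i → eval F (lookup ts i) v ≡ lookup (evals F ts v) i
    lookup-evals (t ∷ ts) v zero    = refl
    lookup-evals (t ∷ ts) v (suc i) = lookup-evals ts v i

  DefinedBy : ∀ {n} → Pred (Vec Carrier n) ℓ → FormulaOver L C n → Set ℓ
  DefinedBy X ψ = ∀ v → X v ⇔ SatOver F ⟦_⟧ᶜ ψ v

  private
    combine : ∀ {n} → (∀ {m} → Formula L m → Formula L m → Formula L m) →
              FormulaOver L C n → FormulaOver L C n → FormulaOver L C n
    combine {n} _⊛_ (k , φ , b) (k′ , φ′ , b′) =
      k ℕ.+ k′ , sub (var ∘ wkˡ n) φ ⊛ sub (var ∘ wkʳ n) φ′ , b ++ b′

    left : ∀ {n k k′} (v : Vec Carrier n) (b : Vec C k) (b′ : Vec C k′) φ →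
      Sat F (sub (var ∘ wkˡ n) φ) (env v b b′) ⇔ Sat F φ (v ++ map ⟦_⟧ᶜ b)
    left {n} v b b′ = Sat-sub F (var ∘ wkˡ n) (lookup-wkˡ v b b′)

    right : ∀ {n k k′} (v : Vec Carrier n) (b : Vec C k) (b′ : Vec C k′) φ →
      Sat F (sub (var ∘ wkʳ n) φ) (env v b b′) ⇔ Sat F φ (v ++ map ⟦_⟧ᶜ b′)
    right {n} v b b′ = Sat-sub F (var ∘ wkʳ n) (lookup-wkʳ v b b′)

  formulaOver : ∀ {n} (φ : Fm n) → Σ[ ψ ∈ FormulaOver L C n ] DefinedBy ⟦ φ ⟧ ψ
  formulaOver (base ψ) = ψ , λ v → mk⇔ id id
  formulaOver {n} (_[_] {m = m} φ ts) with formulaOver φ | termsOver ts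
  ... | (k , φ′ , b) , h | (k′ , us , b′) , e =
    (k ℕ.+ k′ , sub σ φ′ , b ++ b′) , λ v → mk⇔
      (λ p → from (Sat-sub F σ (σ-eval v) φ′) (to (h (⟦ ts ⟧* v)) p))
      (λ p → from (h (⟦ ts ⟧* v)) (to (Sat-sub F σ (σ-eval v) φ′) p))
    where
    -- The variables of `φ′` become the terms `us`, whose parameters form the right block; the
    -- parameters of `φ′` form the left block.
    σ : Fin (m ℕ.+ k) → Term L (n ℕ.+ (k ℕ.+ k′))
    σ i = [ (λ j → renᵗ (wkʳ n) (lookup us j)) , (λ j → var (n ↑ʳ (j ↑ˡ k′))) ]′ (splitAt m i)
    σ-eval : ∀ v i → eval F (σ i) (env v b b′) ≡ lookup (⟦ ts ⟧* v ++ map ⟦_⟧ᶜ b) i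
    σ-eval v i = trans (g (splitAt m i)) (sym (lookup-splitAt m (⟦ ts ⟧* v) _ i))
      where
      g : ∀ s → eval F ([ (λ j → renᵗ (wkʳ n) (lookup us j)) , (λ j → var (n ↑ʳ (j ↑ˡ k′))) ]′ s)
                  (env v b b′) ≡ [ lookup (⟦ ts ⟧* v) , lookup (map ⟦_⟧ᶜ b) ]′ s
      g (inj₁ j) = trans (eval-ren F (wkʳ n) (lookup-wkʳ v b b′) (lookup us j))
        (trans (lookup-evals us _ j) (cong (λ xs → lookup xs j) (e v)))
      g (inj₂ j) = lookup-b v b b′ j
  formulaOver (s == t) with termsOver (s ∷ t ∷ [])
  ... | (k , s′ ∷ t′ ∷ [] , b) , e = (k , s′ ≐̇ t′ , b) , λ v →
    let es , et = ∷-injective (e v) ; et = proj₁ (∷-injective et) in mk⇔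
      (λ p → trans es (trans p (sym et)))
      (λ p → trans (sym es) (trans p et))
  formulaOver (φ ∧ ψ) with formulaOver φ | formulaOver ψ
  ... | x@(k , φ′ , b) , h | y@(k′ , ψ′ , b′) , h′ = combine _∧̇_ x y , λ v → mk⇔
    (λ (p , q) → from (left v b b′ φ′) (to (h v) p) , from (right v b b′ ψ′) (to (h′ v) q))
    (λ (p , q) → from (h v) (to (left v b b′ φ′) p) , from (h′ v) (to (right v b b′ ψ′) q))
  formulaOver (φ ∨ ψ) with formulaOver φ | formulaOver ψ
  ... | x@(k , φ′ , b) , h | y@(k′ , ψ′ , b′) , h′ = combine _∨̇_ x y , λ v → mk⇔
    (Sum.map (from (left v b b′ φ′) ∘ to (h v)) (from (right v b b′ ψ′) ∘ to (h′ v)))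
    (Sum.map (from (h v) ∘ to (left v b b′ φ′)) (from (h′ v) ∘ to (right v b b′ ψ′)))
  formulaOver (neg φ) with formulaOver φ
  ... | (k , φ′ , b) , h = (k , φ′ ⇒̇ ⊥̇ , b) , λ v → mk⇔
    (λ p q → lift (p (from (h v) q)))
    (λ p q → lower (p (to (h v) q)))
  formulaOver (ex φ) with formulaOver φ
  ... | (k , φ′ , b) , h = (k , ∃̇ φ′ , b) , λ v → mk⇔
    (λ (x , p) → x , to (h (x ∷ v)) p)
    (λ (x , p) → x , from (h (x ∷ v)) p)

-- Dimension

module DimensionTheory (em : ∀ {a} → ExcludedMiddle a) {ℓ} {L : Language ℓ} (S : RingSymbols L)
  (F : Structure L) (dim : Dimension F) where

  open Structure F
  open Dimension dim
  open FieldOps S F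
  open DefinableSets S F {Carrier} id public

  abstract
    definable : ∀ {n} (φ : Fm n) → Definable F ⟦ φ ⟧
    definable φ with formulaOver φ
    ... | (k , ψ , b) , h = (k , ψ , map id b) , (λ {v} → to (h v)) , (λ {v} → from (h v))

  ∣_∣ : ∀ {n} → Fm n → ℝ≥0∞ ℓ
  ∣ φ ∣ = δ (definable φ)

  redefine : ∀ {n} {X : Pred (Vec Carrier n) ℓ} (φ : Fm n) → (∀ v → ⟦ φ ⟧ v ⇔ X v) → Definable F X
  redefine φ h with definable φ
  ... | ψ , (f , g) = ψ , (λ {v} x → f (from (h v) x)) , (λ {v} x → to (h v) (g x))

  ∣∣-redefine : ∀ {n} {X : Pred (Vec Carrier n) ℓ} (φ : Fm n) (h : ∀ v → ⟦ φ ⟧ v ⇔ X v) →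
                ∣ φ ∣ ≈ δ (redefine φ h)
  ∣∣-redefine φ h = δ-cong _ _ ((λ {v} → to (h v)) , (λ {v} → from (h v)))

  -- `φ` defines the same set as `φ ∧ ψ`, so the axiom on intersections applies.
  ∣∣-mono : ∀ {n} (φ ψ : Fm n) → ⟦ φ ⟧ ⊆ ⟦ ψ ⟧ → ∣ φ ∣ ≤ ∣ ψ ∣
  ∣∣-mono φ ψ φ⊆ψ c =
    proj₁ (δ-cong (definable φ) (definable (φ ∧ ψ)) ((λ x → x , φ⊆ψ x) , proj₁))
      (δ-∩ (definable φ) (definable ψ) (definable (φ ∧ ψ)) (inj₂ c))

  ∣∣-finite : ∀ {n} (φ : Fm n) → Finite {L = L} ⟦ φ ⟧ → ∣ φ ∣ ≤ 0∞
  ∣∣-finite φ fin = proj₁ (δ-finite (definable φ) fin)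

  ∣∣⇒δᵗ : ∀ {n} {X : Pred (Vec Carrier n) ℓ} (φ : Fm n) → X ⊆ ⟦ φ ⟧ → δᵗ X ≤ ∣ φ ∣
  ∣∣⇒δᵗ {X = X} φ X⊆φ c = let ψ , f , g = definable φ in
    (ψ , λ x → f (X⊆φ x)) , proj₂ (δ-cong (definable φ) (⟪⟫-definable F ψ) ((λ {v} → f {v}) , (λ {v} → g {v}))) c

  δᵗ⇒∣∣ : ∀ {n} {X : Pred (Vec Carrier n) ℓ} {q} → cut (δᵗ X) q →
          ∃[ φ ] X ⊆ ⟦ φ ⟧ × cut ∣ φ ∣ q
  δᵗ⇒∣∣ {X = X} (((k , ψ , b) , X⊆ψ) , c) =
    base (k , ψ , b) , (λ {v} x → same (X⊆ψ x)) ,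
    proj₁ (δ-cong (definable (base (k , ψ , b))) (⟪⟫-definable F (k , ψ , b))
      ((λ {v} → subst (λ b → Sat F ψ (v ++ b)) (map-id b)) , (λ {v} → same))) c
    where
    same : ∀ {v} → ⟪_⟫ F (k , ψ , b) v → SatOver F id (k , ψ , b) v
    same {v} = subst (λ b → Sat F ψ (v ++ b)) (sym (map-id b))

  -- Graphs, fibres and images of maps given by terms

  ⊤ᶠ : ∀ {n} → Fm n
  ⊤ᶠ = con 0ᶠ == con 0ᶠ

  renTm : ∀ {n m} → (Fin n → Fin m) → Tm n → Tm m
  renTm ρ (var i)  = var (ρ i)
  renTm ρ (con c)  = con c
  renTm ρ (s +ᵗ t) = renTm ρ s +ᵗ renTm ρ t
  renTm ρ (s *ᵗ t) = renTm ρ s *ᵗ renTm ρ t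
  renTm ρ (-ᵗ t)   = -ᵗ renTm ρ t

  ⟦renTm⟧ : ∀ {n m} (ρ : Fin n → Fin m) {v w} → (∀ i → lookup w (ρ i) ≡ lookup v i) →
            ∀ t → ⟦ renTm ρ t ⟧ₜ w ≡ ⟦ t ⟧ₜ v
  ⟦renTm⟧ ρ h (var i)  = h i
  ⟦renTm⟧ ρ h (con c)  = refl
  ⟦renTm⟧ ρ h (s +ᵗ t) = cong₂ _⊕_ (⟦renTm⟧ ρ h s) (⟦renTm⟧ ρ h t)
  ⟦renTm⟧ ρ h (s *ᵗ t) = cong₂ _⊗_ (⟦renTm⟧ ρ h s) (⟦renTm⟧ ρ h t)
  ⟦renTm⟧ ρ h (-ᵗ t)   = cong ⊝_ (⟦renTm⟧ ρ h t)

  ⟦map-renTm⟧ : ∀ {n m k} (ρ : Fin n → Fin m) {v w} → (∀ i → lookup w (ρ i) ≡ lookup v i) →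
                ∀ (ts : Vec (Tm n) k) → ⟦ map (renTm ρ) ts ⟧* w ≡ ⟦ ts ⟧* v
  ⟦map-renTm⟧ ρ h []       = refl
  ⟦map-renTm⟧ ρ h (t ∷ ts) = cong₂ _∷_ (⟦renTm⟧ ρ h t) (⟦map-renTm⟧ ρ h ts)

  ⟦map-con⟧ : ∀ {n m} (y : Vec Carrier m) (v : Vec Carrier n) → ⟦ map con y ⟧* v ≡ y
  ⟦map-con⟧ []      v = refl
  ⟦map-con⟧ (x ∷ y) v = cong (x ∷_) (⟦map-con⟧ y v)

  ⟦tabulate-var⟧ : ∀ {n m} (ρ : Fin m → Fin n) {v : Vec Carrier n} {w : Vec Carrier m} →
                   (∀ i → lookup v (ρ i) ≡ lookup w i) → ⟦ tabulate (var ∘ ρ) ⟧* v ≡ w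
  ⟦tabulate-var⟧ ρ {w = []}    h = refl
  ⟦tabulate-var⟧ ρ {w = x ∷ w} h = cong₂ _∷_ (h zero) (⟦tabulate-var⟧ (ρ ∘ suc) (h ∘ suc))

  eqs : ∀ {n m} → Vec (Tm n) m → Vec (Tm n) m → Fm n
  eqs []       []       = ⊤ᶠ
  eqs (s ∷ ss) (t ∷ ts) = s == t ∧ eqs ss ts

  ⟦eqs⟧ : ∀ {n m} (ss ts : Vec (Tm n) m) v → ⟦ eqs ss ts ⟧ v ⇔ ⟦ ss ⟧* v ≡ ⟦ ts ⟧* v
  ⟦eqs⟧ []       []       v = mk⇔ (λ _ → refl) (λ _ → refl)
  ⟦eqs⟧ (s ∷ ss) (t ∷ ts) v = mk⇔
    (λ (p , q) → cong₂ _∷_ p (to (⟦eqs⟧ ss ts v) q))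
    (λ e → proj₁ (∷-injective e) , from (⟦eqs⟧ ss ts v) (proj₂ (∷-injective e)))

  fibre : ∀ {n m} → Fm n → Vec (Tm n) m → Vec Carrier m → Fm n
  fibre X f y = X ∧ eqs f (map con y)

  ⟦fibre⟧ : ∀ {n m} (X : Fm n) (f : Vec (Tm n) m) y v →
            ⟦ fibre X f y ⟧ v ⇔ (⟦ X ⟧ v × ⟦ f ⟧* v ≡ y)
  ⟦fibre⟧ X f y v = mk⇔
    (λ (p , q) → p , trans (to (⟦eqs⟧ f (map con y) v) q) (⟦map-con⟧ y v))
    (λ (p , q) → p , from (⟦eqs⟧ f (map con y) v) (trans q (sym (⟦map-con⟧ y v))))

  graph : ∀ {n m} → Fm n → Vec (Tm n) m → Fm (n ℕ.+ m)
  graph {n} {m} X f =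
    X [ tabulate (var ∘ (_↑ˡ m)) ] ∧ eqs (map (renTm (_↑ˡ m)) f) (tabulate (var ∘ (n ↑ʳ_)))

  ⟦graph⟧ : ∀ {n m} (X : Fm n) (f : Vec (Tm n) m) v w →
            ⟦ graph X f ⟧ (v ++ w) ⇔ (⟦ X ⟧ v × ⟦ f ⟧* v ≡ w)
  ⟦graph⟧ {n} {m} X f v w = mk⇔
    (λ (p , q) → subst ⟦ X ⟧ v≡ p , trans (sym f≡) (trans (to (⟦eqs⟧ _ _ (v ++ w)) q) w≡))
    (λ (p , q) → subst ⟦ X ⟧ (sym v≡) p , from (⟦eqs⟧ _ _ (v ++ w)) (trans f≡ (trans q (sym w≡))))
    where
    v≡ : ⟦ tabulate (var ∘ (_↑ˡ m)) ⟧* (v ++ w) ≡ v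
    v≡ = ⟦tabulate-var⟧ (_↑ˡ m) (lookup-++ˡ v w)
    w≡ : ⟦ tabulate (var ∘ (n ↑ʳ_)) ⟧* (v ++ w) ≡ w
    w≡ = ⟦tabulate-var⟧ (n ↑ʳ_) (lookup-++ʳ v w)
    f≡ : ⟦ map (renTm (_↑ˡ m)) f ⟧* (v ++ w) ≡ ⟦ f ⟧* v
    f≡ = ⟦map-renTm⟧ (_↑ˡ m) (lookup-++ˡ v w) f

  exs : ∀ n {m} → Fm (n ℕ.+ m) → Fm m
  exs zero    φ = φ
  exs (suc n) φ = exs n (ex φ)

  ⟦exs⟧ : ∀ n {m} (φ : Fm (n ℕ.+ m)) w → ⟦ exs n φ ⟧ w ⇔ (∃[ v ] ⟦ φ ⟧ (v ++ w))
  ⟦exs⟧ zero    φ w = mk⇔ (λ p → [] , p) (λ { ([] , p) → p })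
  ⟦exs⟧ (suc n) φ w = mk⇔
    (λ p → let v , x , q = to (⟦exs⟧ n (ex φ) w) p in x ∷ v , q)
    (λ { (x ∷ v , q) → from (⟦exs⟧ n (ex φ) w) (v , x , q) })

  image : ∀ {n m} → Fm n → Vec (Tm n) m → Fm m
  image {n} X f = exs n (graph X f)

  ⟦image⟧ : ∀ {n m} (X : Fm n) (f : Vec (Tm n) m) w →
            ⟦ image X f ⟧ w ⇔ (∃[ v ] ⟦ X ⟧ v × ⟦ f ⟧* v ≡ w)
  ⟦image⟧ {n} X f w = mk⇔
    (λ p → let v , q = to (⟦exs⟧ n (graph X f) w) p in v , to (⟦graph⟧ X f v w) q)
    (λ (v , q) → from (⟦exs⟧ n (graph X f) w) (v , from (⟦graph⟧ X f v w) q))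

  fibre-definable : ∀ {n m} (X : Fm n) (f : Vec (Tm n) m) y →
                    Definable F (λ x → ⟦ X ⟧ x × ⟦ f ⟧* x ≡ y)
  fibre-definable X f y = redefine (fibre X f y) (⟦fibre⟧ X f y)

  ∣fibre∣ : ∀ {n m} (X : Fm n) (f : Vec (Tm n) m) y → ∣ fibre X f y ∣ ≈ δ (fibre-definable X f y)
  ∣fibre∣ X f y = ∣∣-redefine (fibre X f y) (⟦fibre⟧ X f y)

  module _ {n m} (X : Fm n) (Y : Fm m) (f : Vec (Tm n) m) (maps : ∀ v → ⟦ X ⟧ v → ⟦ Y ⟧ (⟦ f ⟧* v)) where

    fibre-inequalities : Satisfiable ⟦ X ⟧ → (∀ w → ⟦ Y ⟧ w → ∃[ v ] ⟦ X ⟧ v × ⟦ f ⟧* v ≡ w) →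
      ∣ Y ∣ + inf {I = Σ _ ⟦ Y ⟧} (λ y → δ (fibre-definable X f (proj₁ y))) ≤ ∣ X ∣ ×
      ∣ X ∣ ≤ ∣ Y ∣ + sup {I = Σ _ ⟦ Y ⟧} (λ y → δ (fibre-definable X f (proj₁ y)))
    fibre-inequalities (v₀ , Xv₀) surj =
      δ-fibres (definable X) (definable Y) (v₀ , Xv₀) (⟦ f ⟧* v₀ , maps v₀ Xv₀) ⟦ f ⟧* graph-def
        (λ {v} → maps v) (λ {w} → surj w) (fibre-definable X f)
      where
      graph-def : Definable F (λ v → ⟦ X ⟧ (take n v) × ⟦ f ⟧* (take n v) ≡ drop n v)
      graph-def = redefine (graph X f) λ v →
        subst (λ u → ⟦ graph X f ⟧ u ⇔ (⟦ X ⟧ (take n v) × ⟦ f ⟧* (take n v) ≡ drop n v))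
          (take++drop≡id n v) (⟦graph⟧ X f (take n v) (drop n v))

  module _ {n m} (X : Fm n) (f : Vec (Tm n) m) where

    image-maps : ∀ v → ⟦ X ⟧ v → ⟦ image X f ⟧ (⟦ f ⟧* v)
    image-maps v Xv = from (⟦image⟧ X f _) (v , Xv , refl)

    image-⊆ : (Y : Fm m) → (∀ v → ⟦ X ⟧ v → ⟦ Y ⟧ (⟦ f ⟧* v)) → ⟦ image X f ⟧ ⊆ ⟦ Y ⟧
    image-⊆ Y maps {w} p = let v , Xv , e = to (⟦image⟧ X f w) p in subst ⟦ Y ⟧ e (maps v Xv)

  -- Onto its image the map has one-point fibres, of dimension 0. Roundedness supplies a gap q - p >
  -- 0, and the supremum of the fibre dimensions stays below it.
  ∣∣-injection : ∀ {n m} (X : Fm n) (Y : Fm m) (f : Vec (Tm n) m) →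
    (∀ v → ⟦ X ⟧ v → ⟦ Y ⟧ (⟦ f ⟧* v)) →
    (∀ v w → ⟦ X ⟧ v → ⟦ X ⟧ w → ⟦ f ⟧* v ≡ ⟦ f ⟧* w → v ≡ w) → ∣ X ∣ ≤ ∣ Y ∣
  ∣∣-injection X Y f maps inj {q} Yq with em {P = Satisfiable ⟦ X ⟧}
  -- The axiom on surjections speaks of nonempty sets only.
  ... | no ¬X = ∣∣-finite X (List.[] , λ {v} p → ⊥-elim (¬X (v , p))) (lift (positive ∣ Y ∣ Yq))
  ... | yes X≢∅ with rounded ∣ Y ∣ Yq
  ... | p , p<q , Yp = proj₂ (fibre-inequalities X I f (image-maps X f) X≢∅ (λ w → to (⟦image⟧ X f w)))
        (p , q ℚ.- p , ∣∣-mono I Y (image-⊆ X f Y maps) Yp , sup-cut , ℚₚ.≤-reflexive eq)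
    where
    I = image X f
    0<q-p : 0ℚ ℚ.< q ℚ.- p
    0<q-p = p<q⇒0<q-p p<q
    eq : p ℚ.+ (q ℚ.- p) ≡ q
    eq = trans (cong (p ℚ.+_) (ℚₚ.+-comm q (ℚ.- p))) (trans (sym (ℚₚ.+-assoc p (ℚ.- p) q))
      (trans (cong (ℚ._+ q) (ℚₚ.+-inverseʳ p)) (ℚₚ.+-identityˡ q)))
    sup-cut : cut (sup {I = Σ _ ⟦ I ⟧} (λ y → δ (fibre-definable X f (proj₁ y)))) (q ℚ.- p)
    sup-cut with ℚₚ.<-dense 0<q-p
    ... | r , 0<r , r<q-p = r , 0<r , r<q-p , λ (y , Iy) →
      let v , Xv , e = to (⟦image⟧ X f y) Iy in
      proj₂ (∣fibre∣ X f y) (∣∣-finite (fibre X f y)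
        (v List.∷ List.[] , λ {w} p → let Xw , e′ = to (⟦fibre⟧ X f y w) p in
           here (inj w v Xw Xv (trans e′ (sym e)))) (lift 0<r))

  infixl 7 _×ᶠ_
  _×ᶠ_ : Fm 1 → Fm 1 → Fm 2
  A ×ᶠ B = A [ var zero ∷ [] ] ∧ B [ var (suc zero) ∷ [] ]

  ∣∣-× : ∀ (A B : Fm 1) → Satisfiable ⟦ A ⟧ → Satisfiable ⟦ B ⟧ → ∣ A ×ᶠ B ∣ ≈ ∣ A ∣ + ∣ B ∣
  ∣∣-× A B sA sB =
    let p , q = ∣∣-redefine (A ×ᶠ B) ×-split
        r , s = δ-× (definable A) (definable B) (redefine (A ×ᶠ B) ×-split) sA sB
    in (λ c → p (r c)) , (λ c → s (q c))
    where
    ×-split : ∀ v → ⟦ A ×ᶠ B ⟧ v ⇔ (⟦ A ⟧ (take 1 v) × ⟦ B ⟧ (drop 1 v))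
    ×-split (x ∷ y ∷ []) = mk⇔ id id

  section : Fm 2 → Carrier → Fm 1
  section Z c = Z [ var zero ∷ con c ∷ [] ]

  -- Dimensions measured in units

  module Counting {ε : ℚ} (0<ε : 0ℚ ℚ.< ε) where

    open Units 0<ε public renaming (_≺_ to _≺ᶜ_) hiding (≺-mono)

    infix 4 _≺_
    -- A record, so that unification does not unfold the multiple k ∙ ε.
    record _≺_ {n} (φ : Fm n) (k : ℕ) : Set ℓ where
      constructor ⟨_⟩
      field bound : ∣ φ ∣ ≺ᶜ k
    open _≺_

    ≺-mono : ∀ {n} (φ : Fm n) {k l} → k ℕ.≤ l → φ ≺ k → φ ≺ l
    ≺-mono φ k≤l φ≺ = ⟨ Units.≺-mono 0<ε ∣ φ ∣ k≤l (bound φ≺) ⟩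

    ≺-pos : ∀ {n} (φ : Fm n) {k} → φ ≺ k → 0 ℕ.< k
    ≺-pos φ φ≺ = ≺⇒pos ∣ φ ∣ (bound φ≺)

    ≺-⊆ : ∀ {n} (φ ψ : Fm n) → ⟦ φ ⟧ ⊆ ⟦ ψ ⟧ → ∀ {k} → ψ ≺ k → φ ≺ k
    ≺-⊆ φ ψ φ⊆ψ ψ≺ = ⟨ ∣∣-mono φ ψ φ⊆ψ (bound ψ≺) ⟩

    ≺-injection : ∀ {n m} (X : Fm n) (Y : Fm m) (f : Vec (Tm n) m) →
      (∀ v → ⟦ X ⟧ v → ⟦ Y ⟧ (⟦ f ⟧* v)) →
      (∀ v w → ⟦ X ⟧ v → ⟦ X ⟧ w → ⟦ f ⟧* v ≡ ⟦ f ⟧* w → v ≡ w) → ∀ {k} → Y ≺ k → X ≺ k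
    ≺-injection X Y f maps inj Y≺ = ⟨ ∣∣-injection X Y f maps inj (bound Y≺) ⟩

    ≺-finite : ∀ {n} (φ : Fm n) {k} → 0 ℕ.< k → Finite {L = L} ⟦ φ ⟧ → φ ≺ k
    ≺-finite φ 0<k fin = ⟨ ∣∣-finite φ fin (0∞≺ 0<k) ⟩

    ≺-empty : ∀ {n} (φ : Fm n) {k} → 0 ℕ.< k → ¬ Satisfiable ⟦ φ ⟧ → φ ≺ k
    ≺-empty φ 0<k ¬φ = ≺-finite φ 0<k (List.[] , λ {v} p → ⊥-elim (¬φ (v , p)))

    ⊀⇒satisfiable : ∀ {n} (φ : Fm n) {k} → 0 ℕ.< k → ¬ φ ≺ k → Satisfiable ⟦ φ ⟧
    ⊀⇒satisfiable φ 0<k φ⊀ with em {P = Satisfiable ⟦ φ ⟧}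
    ... | yes s = s
    ... | no ¬s = ⊥-elim (φ⊀ (≺-empty φ 0<k ¬s))

    ≺-∨ : ∀ {n} (φ ψ : Fm n) {k} → φ ≺ k → ψ ≺ k → φ ∨ ψ ≺ k
    ≺-∨ φ ψ ⟨ p ⟩ ⟨ q ⟩ = ⟨ proj₁ (δ-∪ (definable φ) (definable ψ) (definable (φ ∨ ψ))) (p , q) ⟩

    ≺-× : ∀ (A B : Fm 1) {k l} → A ≺ k → B ≺ l → A ×ᶠ B ≺ k ℕ.+ l
    ≺-× A B {k} {l} p q with em {P = Satisfiable ⟦ A ⟧} | em {P = Satisfiable ⟦ B ⟧}
    ... | yes a | yes b = ⟨ proj₁ (∣∣-× A B a b) (+-≺ ∣ A ∣ ∣ B ∣ {k} {l} (bound p) (bound q)) ⟩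
    ... | no ¬a | _ = ≺-empty (A ×ᶠ B) (ℕₚ.≤-trans (≺-pos A p) (ℕₚ.m≤m+n k l))
                        (λ { (x ∷ y ∷ [] , a , b) → ¬a (_ , a) })
    ... | yes _ | no ¬b = ≺-empty (A ×ᶠ B) (ℕₚ.≤-trans (≺-pos A p) (ℕₚ.m≤m+n k l))
                            (λ { (x ∷ y ∷ [] , a , b) → ¬b (_ , b) })

    ⊀-× : ∀ (A B : Fm 1) {k l} → 0 ℕ.< k → 0 ℕ.< l → ¬ A ≺ k → ¬ B ≺ l → ¬ A ×ᶠ B ≺ k ℕ.+ l
    ⊀-× A B {k} {l} 0<k 0<l p q ⟨ c ⟩ =
      p ⟨ +-≺⁻ ∣ A ∣ ∣ B ∣ {k} {l} (proj₂ (∣∣-× A B (⊀⇒satisfiable A 0<k p) (⊀⇒satisfiable B 0<l q)) c)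
        (λ b → q ⟨ b ⟩) ⟩

    -- Replacing `Y` by the image makes the map onto, and every fibre then passes through a point of
    -- `X`; hence a bound on those fibres is enough.
    ≺-fibres : ∀ {n m} (X : Fm n) (Y : Fm m) (f : Vec (Tm n) m) →
      (∀ v → ⟦ X ⟧ v → ⟦ Y ⟧ (⟦ f ⟧* v)) → ∀ {k l} → Y ≺ l →
      (∀ v → ⟦ X ⟧ v → fibre X f (⟦ f ⟧* v) ≺ k) → X ≺ l ℕ.+ k
    ≺-fibres X Y f maps {k} {l} Y≺ fib≺ with em {P = Satisfiable ⟦ X ⟧}
    ... | no ¬X = ≺-empty X (ℕₚ.≤-trans (≺-pos Y Y≺) (ℕₚ.m≤m+n l k)) ¬X
    ... | yes X≢∅@(v₀ , Xv₀) =
      ⟨ proj₂ (fibre-inequalities X I f (image-maps X f) X≢∅ (λ w → to (⟦image⟧ X f w)))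
        (+-sup-≺ ∣ I ∣ (λ (y : Σ _ ⟦ I ⟧) → δ (fibre-definable X f (proj₁ y))) {l} {k}
          (bound (≺-⊆ I Y (image-⊆ X f Y maps) Y≺)) (≺-pos (fibre X f (⟦ f ⟧* v₀)) (fib≺ v₀ Xv₀))
          (λ (y , Iy) → proj₂ (∣fibre∣ X f y) (bound (small y Iy)))) ⟩
      where
      I = image X f
      small : ∀ y → ⟦ I ⟧ y → fibre X f y ≺ k
      small y Iy with to (⟦image⟧ X f y) Iy
      ... | v , Xv , refl = fib≺ v Xv

    -- By the lower fibre inequality the fibres use up k of the l + k units of `X`, which leaves l
    -- for `Y`.
    ≺-fibres⁻ : ∀ {n m} (X : Fm n) (Y : Fm m) (f : Vec (Tm n) m) →
      (∀ v → ⟦ X ⟧ v → ⟦ Y ⟧ (⟦ f ⟧* v)) → (∀ w → ⟦ Y ⟧ w → ∃[ v ] ⟦ X ⟧ v × ⟦ f ⟧* v ≡ w) →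
      ∀ {k l} → 0 ℕ.< l → X ≺ l ℕ.+ k → (∀ w → ⟦ Y ⟧ w → ¬ fibre X f w ≺ k) → Y ≺ l
    ≺-fibres⁻ X Y f maps surj {k} {l} 0<l X≺ fib⊀ with em {P = Satisfiable ⟦ Y ⟧}
    ... | no ¬Y = ≺-empty Y 0<l ¬Y
    ... | yes (w₀ , Yw₀) =
      ⟨ +-≺⁻ ∣ Y ∣ (inf {I = Σ _ ⟦ Y ⟧} (λ y → δ (fibre-definable X f (proj₁ y)))) {l} {k}
        (proj₁ (fibre-inequalities X Y f maps (let v , Xv , _ = surj w₀ Yw₀ in v , Xv) surj) (bound X≺))
        (λ ((y , Yy) , c) → fib⊀ y Yy ⟨ proj₁ (∣fibre∣ X f y) c ⟩) ⟩

    private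
      -- Continuity between s and s + 1 units gives a definable D that contains the parameters with
      -- section of at most s units and contains only parameters with section below s + 1 units. `E`
      -- is its complement. Having a large section becomes definable at the price of one unit of
      -- uncertainty.
      threshold′ : (Z : Fm 2) → ∀ s → Σ[ E ∈ Fm 1 ]
        (∀ c → ¬ section Z c ≺ suc s → ⟦ E ⟧ (c ∷ [])) ×
        (∀ c → ⟦ E ⟧ (c ∷ []) → ¬ section Z c ≺ s)
      threshold′ Z s with formulaOver Z
      ... | (k , φ , b) , h = neg (base (k , D , b)) ,
        (λ c Z⊀t Dc → let q , δq , q≯t = D⇒ (c ∷ map id b) Dc in
          Z⊀t ⟨ proj₁ (sec≈ c) (upper (δ (sec c)) δq (ℚₚ.≮⇒≥ λ t<q → q≯t (lift (positive (δ (sec c)) δq , t<q)))) ⟩) ,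
        (λ c ¬Dc (⟨ Z≺s ⟩) → ¬Dc (⇒D (c ∷ map id b)
          λ (lift (0<q , s<q)) → upper (δ (sec c)) (proj₂ (sec≈ c) Z≺s) (ℚₚ.<⇒≤ s<q)))
        where
        t = suc s
        -- The second variable of `Z` is counted among the parameters, ahead of `b`.
        continuous = δ-continuous {1} {suc k} φ (fromℚ (s ∙ ε)) (fromℚ (t ∙ ε))
          (t ∙ ε , lift (∙-pos 0<ε s , ∙-strict 0<ε s) , λ (lift (_ , t<t)) → ℚₚ.<-irrefl refl t<t)
          (suc t ∙ ε , lift (∙-pos 0<ε t , ∙-strict 0<ε t) , λ ())
        D = proj₁ continuous
        ⇒D = proj₁ (proj₂ continuous)
        D⇒ = proj₂ (proj₂ continuous)
        sec : ∀ c → Definable F (⟪_⟫ F {n = 1} (suc k , φ , c ∷ map id b))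
        sec c = ⟪⟫-definable F {1} (suc k , φ , c ∷ map id b)
        sec≈ : ∀ c → ∣ section Z c ∣ ≈ δ (sec c)
        sec≈ c = δ-cong _ _
          ( (λ { {x ∷ []} p → to (h (x ∷ c ∷ [])) p })
          , (λ { {x ∷ []} p → from (h (x ∷ c ∷ [])) p }))

    abstract
      threshold : (Z : Fm 2) → ∀ s → Σ[ E ∈ Fm 1 ]
        (∀ c → ¬ section Z c ≺ suc s → ⟦ E ⟧ (c ∷ [])) ×
        (∀ c → ⟦ E ⟧ (c ∷ []) → ¬ section Z c ≺ s)
      threshold = threshold′

-- Compactness

module Compactness (em : ∀ {a} → ExcludedMiddle a) {ℓ} {L : Language ℓ} (S : RingSymbols L)
  (F : Structure L) {K : Set ℓ} (ℕ↣K : ℕ ↣ K) (saturated : Saturated F K)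
  (Y : Pred (Structure.Carrier F) ℓ) (a : K → Structure.Carrier F) (Γ : Pred (FormulaOver L K 1) ℓ)
  (Y≐Γ : FieldOps.⌜_⌝ S F Y ≐ Realizes F a Γ) where

  open Structure F
  open FieldOps S F
  open DefinableSets S F {Carrier} id

  -- Finite parts of the type of Y. Concatenation makes the sets `Φ i` a downward directed family of
  -- definable supersets of Y.
  Index : Set ℓ
  Index = List (Σ (FormulaOver L K 1) Γ)

  Φ : Index → Fm 1
  Φ List.[] = con 0ᶠ == con 0ᶠ
  Φ (((k , φ , c) , _) List.∷ i) = base (k , φ , map a c) ∧ Φ i

  Y⊆Φ : ∀ i {y} → Y y → ⟦ Φ i ⟧ (y ∷ [])
  Y⊆Φ List.[] _ = refl
  Y⊆Φ (((k , φ , c) , γ) List.∷ i) {y} Yy =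
    subst (λ b → Sat F φ (y ∷ b)) (sym (map-id (map a c))) (proj₁ Y≐Γ {y ∷ []} Yy γ) , Y⊆Φ i Yy

  Φ-++ˡ : ∀ i j → ⟦ Φ (i List.++ j) ⟧ ⊆ ⟦ Φ i ⟧
  Φ-++ˡ List.[]      j _       = refl
  Φ-++ˡ (_ List.∷ i) j (p , q) = p , Φ-++ˡ i j q

  Φ-++ʳ : ∀ i j → ⟦ Φ (i List.++ j) ⟧ ⊆ ⟦ Φ j ⟧
  Φ-++ʳ List.[]      j p       = p
  Φ-++ʳ (_ List.∷ i) j (p , q) = Φ-++ʳ i j q

  private
    f : ℕ → K
    f = Injection.to ℕ↣K

    prepend : ∀ {k} → Vec Carrier k → (ℕ → Carrier) → ℕ → Carrier
    prepend []      s n       = s n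
    prepend (x ∷ b) s zero    = x
    prepend (x ∷ b) s (suc n) = prepend b s n

    prepend-< : ∀ {k} (b : Vec Carrier k) s j → prepend b s (toℕ j) ≡ lookup b j
    prepend-< (x ∷ b) s zero    = refl
    prepend-< (x ∷ b) s (suc j) = prepend-< b s j

    prepend-≥ : ∀ {k} (b : Vec Carrier k) s n → prepend b s (k ℕ.+ n) ≡ s n
    prepend-≥ []      s n = refl
    prepend-≥ (x ∷ b) s n = prepend-≥ b s n

    -- Room for k further parameters b is made by shifting the copy of ℕ in K by k.
    module _ {k} (b : Vec Carrier k) where

      a⁺ : K → Carrier
      a⁺ x with em {P = ∃[ n ] f n ≡ x}
      ... | yes (n , _) = prepend b (a ∘ f) n
      ... | no _        = a x

      a⁺-f : ∀ n → a⁺ (f n) ≡ prepend b (a ∘ f) n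
      a⁺-f n with em {P = ∃[ m ] f m ≡ f n}
      ... | yes (m , e) = cong (prepend b (a ∘ f)) (Injection.injective ℕ↣K e)
      ... | no ¬e       = ⊥-elim (¬e (n , refl))

      rename : K → K
      rename x with em {P = ∃[ n ] f n ≡ x}
      ... | yes (n , _) = f (k ℕ.+ n)
      ... | no _        = x

      a⁺-rename : ∀ x → a⁺ (rename x) ≡ a x
      a⁺-rename x with em {P = ∃[ n ] f n ≡ x} in eq
      ... | yes (n , refl) = trans (a⁺-f (k ℕ.+ n)) (prepend-≥ b (a ∘ f) n)
      ... | no ¬e rewrite eq = refl

      new : Vec K k
      new = tabulate (f ∘ toℕ)

      a⁺-new : map a⁺ new ≡ b
      a⁺-new = trans (sym (tabulate-∘ a⁺ (f ∘ toℕ)))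
        (trans (tabulate-cong (λ j → trans (a⁺-f (toℕ j)) (prepend-< b (a ∘ f) j))) (tabulate∘lookup b))

      a⁺-map-rename : ∀ {m} (c : Vec K m) → map a⁺ (map rename c) ≡ map a c
      a⁺-map-rename c = trans (sym (map-∘ a⁺ rename c)) (map-cong a⁺-rename c)

  private
    -- If every `Φ i` had a tuple violating `R`, the negation of `R` together with `Γ` imposed on
    -- each coordinate would be finitely satisfiable. Saturation would then yield a tuple from Y
    -- violating `R`.
    compactness′ : ∀ {n} (R : Fm n) → (∀ v → (∀ j → Y (lookup v j)) → ⟦ R ⟧ v) →
      ∃[ i ] (∀ v → (∀ j → ⟦ Φ i ⟧ (lookup v j ∷ [])) → ⟦ R ⟧ v)
    compactness′ {n} R Y⇒R with em {P = ∃[ i ] (∀ v → (∀ j → ⟦ Φ i ⟧ (lookup v j ∷ [])) → ⟦ R ⟧ v)}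
    ... | yes p = p
    ... | no ¬p with formulaOver R
    ... | (k , ρ , b) , R⇔ρ = ⊥-elim (¬ρv (ρ-holds (Y⇒R v Yv)))
      where
      -- In this reading the first k names in the copy of ℕ denote the parameters of `R`, and
      -- renamed names denote what they did under `a`.
      module D = DefinableSets S F {K} (a⁺ b)

      ¬ρ : D.Fm n
      ¬ρ = D.neg (D.base (k , ρ , new b))

      ⟦¬ρ⟧ : ∀ v → ¬ ⟦ R ⟧ v → D.⟦ ¬ρ ⟧ v
      ⟦¬ρ⟧ v ¬Rv s = ¬Rv (from (R⇔ρ v)
        (subst (λ c → Sat F ρ (v ++ c)) (trans (a⁺-new b) (sym (map-id b))) s))

      at : Fin n → FormulaOver L K 1 → D.Fm n
      at j (k , φ , c) = D.base (k , φ , map (rename b) c) D.[ D.var j ∷ [] ]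

      Γ⁺ : Pred (FormulaOver L K n) ℓ
      Γ⁺ ψ = ψ ≡ proj₁ (D.formulaOver ¬ρ) ⊎
        Σ[ χ ∈ FormulaOver L K 1 ] Γ χ × Σ[ j ∈ Fin n ] ψ ≡ proj₁ (D.formulaOver (at j χ))

      collect : ∀ {ψs} → All Γ⁺ ψs → Index
      collect []                       = List.[]
      collect (inj₁ _ ∷ γs)            = collect γs
      collect (inj₂ (χ , γ , _) ∷ γs) = (χ , γ) List.∷ collect γs

      collect-sat : ∀ {ψs} (γs : All Γ⁺ ψs) v → (∀ j → ⟦ Φ (collect γs) ⟧ (lookup v j ∷ [])) →
        ¬ ⟦ R ⟧ v → All (λ ψ → SatOver F (a⁺ b) ψ v) ψs
      collect-sat [] v Φv ¬Rv = []
      collect-sat (inj₁ refl ∷ γs) v Φv ¬Rv =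
        to (proj₂ (D.formulaOver ¬ρ) v) (⟦¬ρ⟧ v ¬Rv) ∷ collect-sat γs v Φv ¬Rv
      collect-sat (inj₂ ((m , φ , c) , γ , j , refl) ∷ γs) v Φv ¬Rv =
        to (proj₂ (D.formulaOver (at j (m , φ , c))) v)
          (subst (λ b → Sat F φ (lookup v j ∷ b)) (trans (map-id (map a c)) (sym (a⁺-map-rename b c))) (proj₁ (Φv j)))
        ∷ collect-sat γs v (λ j → proj₂ (Φv j)) ¬Rv

      consistent : Consistent F (a⁺ b) Γ⁺
      consistent ψs γs with em {P = ∃[ v ] (∀ j → ⟦ Φ (collect γs) ⟧ (lookup v j ∷ [])) × ¬ ⟦ R ⟧ v}
      ... | yes (v , Φv , ¬Rv) = v , collect-sat γs v Φv ¬Rv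
      ... | no ¬v = ⊥-elim (¬p (collect γs , λ v Φv → R-holds v Φv))
        where
        R-holds : ∀ v → (∀ j → ⟦ Φ (collect γs) ⟧ (lookup v j ∷ [])) → ⟦ R ⟧ v
        R-holds v Φv with em {P = ⟦ R ⟧ v}
        ... | yes Rv = Rv
        ... | no ¬Rv = ⊥-elim (¬v (v , Φv , ¬Rv))

      realized : Satisfiable (Realizes F (a⁺ b) Γ⁺)
      realized = saturated (a⁺ b) Γ⁺ consistent

      v = proj₁ realized

      Yv : ∀ j → Y (lookup v j)
      Yv j = proj₂ Y≐Γ λ { {m , φ , c} γ →
        subst (λ b → Sat F φ (lookup v j ∷ b)) (a⁺-map-rename b c)
          (from (proj₂ (D.formulaOver (at j (m , φ , c))) v)
            (proj₂ realized (inj₂ ((m , φ , c) , γ , j , refl)))) }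

      ¬ρv : D.⟦ ¬ρ ⟧ v
      ¬ρv = from (proj₂ (D.formulaOver ¬ρ) v) (proj₂ realized (inj₁ refl))

      ρ-holds : ⟦ R ⟧ v → D.⟦ D.base (k , ρ , new b) ⟧ v
      ρ-holds Rv = subst (λ c → Sat F ρ (v ++ c)) (trans (map-id b) (sym (a⁺-new b))) (to (R⇔ρ v) Rv)

  abstract
    compactness : ∀ {n} (R : Fm n) → (∀ v → (∀ j → Y (lookup v j)) → ⟦ R ⟧ v) →
      ∃[ i ] (∀ v → (∀ j → ⟦ Φ i ⟧ (lookup v j ∷ [])) → ⟦ R ⟧ v)
    compactness = compactness′

-- Sums and popular differences

module FieldTheory {ℓ} {L : Language ℓ} (S : RingSymbols L) (F : Structure L)
  (isField : FieldOps.IsField S F) where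

  open Structure F
  open FieldOps S F
  open IsField isField public

  commutativeRing : CommutativeRing ℓ ℓ
  commutativeRing = record { isCommutativeRing = isCommutativeRing }

  open CommutativeRing commutativeRing public
    using (*-assoc; *-comm; *-identityˡ; zeroˡ; zeroʳ; -‿inverseʳ)
  open IntegerSolver commutativeRing public

  *-cancelˡ : ∀ {x} → x ≢ 0ᶠ → ∀ {y z} → x ⊗ y ≡ x ⊗ z → y ≡ z
  *-cancelˡ {x} x≢0 {y} {z} e =
    let x⁻¹ , xx⁻¹≡1 = inverse x x≢0
        undo : ∀ w → x⁻¹ ⊗ (x ⊗ w) ≡ w
        undo w = trans (solve 3 (λ x x⁻¹ w → x⁻¹ :* (x :* w) := (x :* x⁻¹) :* w) refl x x⁻¹ w)
          (trans (cong (_⊗ w) xx⁻¹≡1) (*-identityˡ w))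
    in trans (sym (undo y)) (trans (cong (x⁻¹ ⊗_) e) (undo z))

  *-nonzero : ∀ {x y} → x ≢ 0ᶠ → y ≢ 0ᶠ → x ⊗ y ≢ 0ᶠ
  *-nonzero {x} x≢0 y≢0 e = y≢0 (*-cancelˡ x≢0 (trans e (sym (zeroʳ x))))

  1≢0 : 1ᶠ ≢ 0ᶠ
  1≢0 e = 0≢1 (sym e)

  +-cancelʳ : ∀ z {x y} → x ⊕ z ≡ y ⊕ z → x ≡ y
  +-cancelʳ z {x} {y} e = trans (solve 2 (λ x z → x := (x :+ z) :- z) refl x z)
    (trans (cong (_⊖ z) e) (solve 2 (λ y z → (y :+ z) :- z := y) refl y z))

  +-cancelˡ : ∀ z {x y} → z ⊕ x ≡ z ⊕ y → x ≡ y
  +-cancelˡ z {x} {y} e = trans (solve 2 (λ x z → x := (z :+ x) :- z) refl x z)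
    (trans (cong (_⊖ z) e) (solve 2 (λ y z → (z :+ y) :- z := y) refl y z))

  x-y≡0⇒x≡y : ∀ {x y} → x ⊖ y ≡ 0ᶠ → x ≡ y
  x-y≡0⇒x≡y {x} {y} e = trans (solve 2 (λ x y → x := (x :- y) :+ y) refl x y)
    (trans (cong (_⊕ y) e) (CommutativeRing.+-identityˡ commutativeRing y))

module FieldFormulas (em : ∀ {a} → ExcludedMiddle a) {ℓ} {L : Language ℓ} (S : RingSymbols L)
  (F : Structure L) (dim : Dimension F) where

  open Structure F
  open FieldOps S F
  open DimensionTheory em S F dim

  infix 4 _∈_
  _∈_ : Carrier → Fm 1 → Set ℓ
  x ∈ X = ⟦ X ⟧ (x ∷ [])

  v₀ : ∀ {n} → Tm (suc n)
  v₀ = var zero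

  v₁ : ∀ {n} → Tm (suc (suc n))
  v₁ = var (suc zero)

  v₂ : ∀ {n} → Tm (suc (suc (suc n)))
  v₂ = var (suc (suc zero))

  -1ᶠ : Carrier
  -1ᶠ = ⊝ 1ᶠ

  -- The set αX + βZ. The inner quantifier ranges over `X`, so a member unpacks with its `Z`-part
  -- first.
  lin : Carrier → Fm 1 → Carrier → Fm 1 → Fm 1
  lin α X β Z = ex (ex (X [ v₀ ∷ [] ] ∧ Z [ v₁ ∷ [] ] ∧ (con α *ᵗ v₀ +ᵗ con β *ᵗ v₁) == v₂))

  lin-intro : ∀ α X β Z {x z} → x ∈ X → z ∈ Z → α ⊗ x ⊕ β ⊗ z ∈ lin α X β Z
  lin-intro α X β Z {x} {z} Xx Zz = z , x , Xx , Zz , refl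

  DifferenceQuotient : Fm 1 → Carrier → Set ℓ
  DifferenceQuotient C z = ∃[ a ] ∃[ b ] ∃[ x ] ∃[ y ]
    a ∈ C × b ∈ C × x ∈ C × y ∈ C × x ⊖ y ≢ 0ᶠ × z ⊗ (x ⊖ y) ≡ a ⊖ b

  difference-quotient-mono : ∀ {C D z} → (∀ {x} → x ∈ C → x ∈ D) →
                             DifferenceQuotient C z → DifferenceQuotient D z
  difference-quotient-mono C⊆D (a , b , x , y , Ca , Cb , Cx , Cy , rest) =
    a , b , x , y , C⊆D Ca , C⊆D Cb , C⊆D Cx , C⊆D Cy , rest

module FieldCounting (em : ∀ {a} → ExcludedMiddle a) {ℓ} {L : Language ℓ} (S : RingSymbols L)
  (F : Structure L) (isField : FieldOps.IsField S F) (dim : Dimension F)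
  {ε : ℚ} (0<ε : 0ℚ ℚ.< ε) where

  open Structure F
  open FieldOps S F
  open FieldTheory S F isField
  open DimensionTheory em S F dim
  open Counting 0<ε
  open FieldFormulas em S F dim

  -- Z parametrizes, through (g , h), representations s = σu + τv with (u , v) ∈ U × V.
  sum-≺ : ∀ (σ τ : Carrier) (U V W : Fm 1) {p q k l} → U ≺ p → V ≺ q → p ℕ.+ q ≡ l ℕ.+ k →
    0 ℕ.< l → 0 ℕ.< k →
    (∀ s → s ∈ W → Σ[ Z ∈ Fm 1 ] ¬ Z ≺ k × Σ[ g ∈ Tm 1 ] Σ[ h ∈ Tm 1 ]
      (∀ z w → ⟦ g ⟧ₜ (z ∷ []) ≡ ⟦ g ⟧ₜ (w ∷ []) → z ≡ w) ×
      (∀ z → z ∈ Z → ⟦ g ⟧ₜ (z ∷ []) ∈ U × ⟦ h ⟧ₜ (z ∷ []) ∈ V ×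
        σ ⊗ ⟦ g ⟧ₜ (z ∷ []) ⊕ τ ⊗ ⟦ h ⟧ₜ (z ∷ []) ≡ s)) →
    W ≺ l
  sum-≺ σ τ U V W {p} {q} {k} {l} U≺ V≺ p+q≡l+k 0<l 0<k reps =
    -- Restricted to pairs with value in `W`, the map (u , v) ↦ σu + τv has a copy of some `Z` in
    -- each fibre, hence fibres of at least k units, while U × V has fewer than l + k.
    ≺-fibres⁻ X W f (λ { (u ∷ v ∷ []) (_ , _ , w) → w }) surj 0<l X≺
      (λ { (s ∷ []) Ws fib≺ → let Z , Z⊀ , g , h , inj , rep = reps s Ws in
        Z⊀ (≺-injection Z (fibre X f (s ∷ [])) (g ∷ h ∷ [])
          (λ { (z ∷ []) Zz → let Ug , Vh , eq = rep z Zz in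
            (Ug , Vh , subst (_∈ W) (sym eq) Ws) , eq , refl })
          (λ { (z ∷ []) (w ∷ []) _ _ e → cong (_∷ []) (inj z w (∷-injectiveˡ e)) }) fib≺) })
    where
    t : Tm 2
    t = con σ *ᵗ v₀ +ᵗ con τ *ᵗ v₁
    f = t ∷ []
    X : Fm 2
    X = U [ v₀ ∷ [] ] ∧ V [ v₁ ∷ [] ] ∧ W [ t ∷ [] ]
    X≺ : X ≺ l ℕ.+ k
    X≺ = subst (X ≺_) p+q≡l+k (≺-⊆ X (U ×ᶠ V) (λ (u , v , _) → u , v) (≺-× U V {p} {q} U≺ V≺))
    surj : ∀ w → ⟦ W ⟧ w → ∃[ v ] ⟦ X ⟧ v × ⟦ f ⟧* v ≡ w
    surj (s ∷ []) Ws with reps s Ws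
    ... | Z , Z⊀ , g , h , _ , rep with ⊀⇒satisfiable Z 0<k Z⊀
    ... | z ∷ [] , Zz = let Ug , Vh , eq = rep z Zz in
      _ ∷ _ ∷ [] , (Ug , Vh , subst (_∈ W) (sym eq) Ws) , cong (_∷ []) eq

  -- z is a quotient of differences as soon as (c , c′) ↦ c + z c′ is not injective on C.
  difference-quotient : ∀ (C E : Fm 1) {k} z → 0 ℕ.< k → ¬ C ≺ k → E ≺ k ℕ.+ k →
    (∀ c c′ → c ∈ C → c′ ∈ C → c ⊕ z ⊗ c′ ∈ E) → DifferenceQuotient C z
  difference-quotient C E {k} r 0<k C⊀ E≺ C+rC⊆E = em⇒dne em λ ¬p →
    ⊀-× C C {k} {k} 0<k 0<k C⊀ C⊀
      (≺-injection (C ×ᶠ C) E ((v₀ +ᵗ con r *ᵗ v₁) ∷ [])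
        (λ { (c ∷ c′ ∷ []) (Cc , Cc′) → C+rC⊆E c c′ Cc Cc′ })
        (λ { (c ∷ c′ ∷ []) (d ∷ d′ ∷ []) (Cc , Cc′) (Cd , Cd′) e → inj ¬p Cc Cc′ Cd Cd′ (∷-injectiveˡ e) }) E≺)
    where
    inj : ¬ DifferenceQuotient C r → ∀ {c c′ d d′} → c ∈ C → c′ ∈ C → d ∈ C → d′ ∈ C → c ⊕ r ⊗ c′ ≡ d ⊕ r ⊗ d′ →
          _≡_ {A = Vec Carrier 2} (c ∷ c′ ∷ []) (d ∷ d′ ∷ [])
    inj ¬p {c} {c′} {d} {d′} Cc Cc′ Cd Cd′ e with em {P = c′ ⊖ d′ ≡ 0ᶠ}
    ... | yes c′-d′≡0 = cong₂ (λ x y → x ∷ y ∷ []) c≡d c′≡d′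
      where
      c′≡d′ = x-y≡0⇒x≡y c′-d′≡0
      c≡d : c ≡ d
      c≡d = trans (solve 2 (λ c y → c := (c :+ y) :- y) refl c (r ⊗ c′))
        (trans (cong₂ _⊖_ e (cong (r ⊗_) c′≡d′)) (solve 2 (λ d y → (d :+ y) :- y := d) refl d (r ⊗ d′)))
    -- From c + r c′ = d + r d′ follows r (c′ - d′) = d - c.
    ... | no c′-d′≢0 = ⊥-elim (¬p (d , c , c′ , d′ , Cd , Cc , Cc′ , Cd′ , c′-d′≢0 ,
      trans (solve 4 (λ c c′ d′ r → r :* (c′ :- d′) := ((c :+ r :* c′) :- c) :- r :* d′) refl c c′ d′ r)
        (trans (cong (λ x → (x ⊖ c) ⊖ r ⊗ d′) e)
          (solve 4 (λ c d d′ r → ((d :+ r :* d′) :- c) :- r :* d′ := d :- c) refl c d d′ r))))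

  module SmallDoubling (e : ℕ) (Y : Pred Carrier ℓ) (A : Fm 1)
    (A⊀ : ¬ A ≺ 100 ℕ.+ e) (A≺ : A ≺ 101 ℕ.+ e)
    (yA-A≺ : ∀ {y} → Y y → lin y A -1ᶠ A ≺ 101 ℕ.+ e)
    {y₀} (Yy₀ : Y y₀) (y₀≢0 : y₀ ≢ 0ᶠ) where

    private
      0< : ∀ {n} → 0 ℕ.< suc n
      0< = ℕ.s≤s ℕ.z≤n

      -- The bookkeeping of losses: if one summand has fewer than m units, the other fewer than k +
      -- n, and the fibres at least n, the bound m rises by k.
      move : ∀ k m n → m ℕ.+ (k ℕ.+ n) ≡ (k ℕ.+ m) ℕ.+ n
      move k m n = trans (sym (ℕₚ.+-assoc m k n)) (cong (ℕ._+ n) (ℕₚ.+-comm m k))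

    -- Every z in `A` gives x + ya = (x + z) + (ya - z). These are at least 100 + e units of
    -- representations, against fewer than 101 + e for yA - A, so one unit is lost.
    +yA-≺ : ∀ {y} → Y y → ∀ X {p} → lin 1ᶠ X 1ᶠ A ≺ p → lin 1ᶠ X y A ≺ 1 ℕ.+ p
    +yA-≺ {y} Yy X {p} X+A≺ = sum-≺ 1ᶠ 1ᶠ (lin 1ᶠ X 1ᶠ A) (lin y A -1ᶠ A) (lin 1ᶠ X y A)
      X+A≺ (yA-A≺ Yy) (move 1 p (100 ℕ.+ e)) 0< (0< {99 ℕ.+ e})
      λ s (a , x , Xx , Aa , x+ya≡s) → A , A⊀ ,
        con 1ᶠ *ᵗ con x +ᵗ con 1ᶠ *ᵗ v₀ , con y *ᵗ con a +ᵗ con -1ᶠ *ᵗ v₀ ,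
        (λ z w eq → *-cancelˡ 1≢0 (+-cancelˡ (1ᶠ ⊗ x) eq)) ,
        (λ z Az → lin-intro 1ᶠ X 1ᶠ A Xx Az , lin-intro y A -1ᶠ A Aa Az , trans (solve 4 (λ x y a z →
          𝟙 :* (𝟙 :* x :+ 𝟙 :* z) :+ 𝟙 :* (y :* a :+ -𝟙 :* z) := 𝟙 :* x :+ y :* a)
          refl x y a z) x+ya≡s)

    -- Here x + a = (x + yz) - (yz - a) for z in `A`, and distinct z give distinct x + yz since y is
    -- nonzero.
    +A-≺ : ∀ {y} → Y y → y ≢ 0ᶠ → ∀ X {p} → lin 1ᶠ X y A ≺ p → lin 1ᶠ X 1ᶠ A ≺ 1 ℕ.+ p
    +A-≺ {y} Yy y≢0 X {p} X+yA≺ = sum-≺ 1ᶠ -1ᶠ (lin 1ᶠ X y A) (lin y A -1ᶠ A) (lin 1ᶠ X 1ᶠ A)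
      X+yA≺ (yA-A≺ Yy) (move 1 p (100 ℕ.+ e)) 0< (0< {99 ℕ.+ e})
      λ s (a , x , Xx , Aa , x+a≡s) → A , A⊀ ,
        con 1ᶠ *ᵗ con x +ᵗ con y *ᵗ v₀ , con y *ᵗ v₀ +ᵗ con -1ᶠ *ᵗ con a ,
        (λ z w eq → *-cancelˡ y≢0 (+-cancelˡ (1ᶠ ⊗ x) eq)) ,
        (λ z Az → lin-intro 1ᶠ X y A Xx Az , lin-intro y A -1ᶠ A Az Aa , trans (solve 4 (λ x y a z →
          𝟙 :* (𝟙 :* x :+ y :* z) :+ -𝟙 :* (y :* z :+ -𝟙 :* a) := 𝟙 :* x :+ 𝟙 :* a)
          refl x y a z) x+a≡s)

    Δ : Fm 1
    Δ = lin 1ᶠ A -1ᶠ A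

    Δ-intro : ∀ {x y} → x ∈ A → y ∈ A → x ⊖ y ∈ Δ
    Δ-intro {x} {y} Ax Ay = subst (_∈ Δ)
      (solve 2 (λ x y → 𝟙 :* x :+ -𝟙 :* y := x :- y) refl x y) (lin-intro 1ᶠ A -1ᶠ A Ax Ay)

    -- The representations are a - b = (y₀z - b) - (y₀z - a) with z in `A`.
    Δ≺ : Δ ≺ 102 ℕ.+ e
    Δ≺ = sum-≺ -1ᶠ 1ᶠ (lin y₀ A -1ᶠ A) (lin y₀ A -1ᶠ A) Δ
      (yA-A≺ Yy₀) (yA-A≺ Yy₀) (move 1 (101 ℕ.+ e) (100 ℕ.+ e)) 0< (0< {99 ℕ.+ e})
      λ s (b , a , Aa , Ab , a-b≡s) → A , A⊀ ,
        con y₀ *ᵗ v₀ +ᵗ con -1ᶠ *ᵗ con a , con y₀ *ᵗ v₀ +ᵗ con -1ᶠ *ᵗ con b ,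
        (λ z w eq → *-cancelˡ y₀≢0 (+-cancelʳ (-1ᶠ ⊗ a) eq)) ,
        (λ z Az → lin-intro y₀ A -1ᶠ A Az Aa , lin-intro y₀ A -1ᶠ A Az Ab , trans (solve 4 (λ y a b z →
          -𝟙 :* (y :* z :+ -𝟙 :* a) :+ 𝟙 :* (y :* z :+ -𝟙 :* b) := 𝟙 :* a :+ -𝟙 :* b)
          refl y₀ a b z) a-b≡s)

    -- Popular differences

    representations : Fm 2
    representations = A [ v₀ ∷ [] ] ∧ A [ (v₀ -ᵗ v₁) ∷ [] ]

    private
      -- Differences outside `T` have fewer than 98 + e units of representations. As `Δ` has fewer
      -- than 102 + e, pairs with such a difference stay below 200 + 2e units, which A × A attains.
      popular = threshold representations (97 ℕ.+ e)

    -- The popular differences of A.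
    T : Fm 1
    T = proj₁ popular

    T-popular : ∀ {t} → t ∈ T → ¬ section representations t ≺ 97 ℕ.+ e
    T-popular {t} = proj₂ (proj₂ popular) t

    ¬T-unpopular : ∀ {t} → ¬ t ∈ T → section representations t ≺ 98 ℕ.+ e
    ¬T-unpopular {t} ¬Tt = em⇒dne em λ ¬p → ¬Tt (proj₁ (proj₂ popular) t ¬p)

    private
      W V : Fm 2
      W = A [ v₀ ∷ [] ] ∧ A [ v₁ ∷ [] ] ∧ neg (T [ (v₀ -ᵗ v₁) ∷ [] ])
      V = A [ v₀ ∷ [] ] ∧ A [ v₁ ∷ [] ] ∧ T [ (v₀ -ᵗ v₁) ∷ [] ]

      -- A pair with difference t is determined by its first entry, so the fibre over t embeds in
      -- the representations of t.
      W≺ : W ≺ (102 ℕ.+ e) ℕ.+ (98 ℕ.+ e)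
      W≺ = ≺-fibres W Δ d (λ { (a ∷ b ∷ []) (Aa , Ab , _) → Δ-intro Aa Ab }) Δ≺
        λ { (a ∷ b ∷ []) (Aa , Ab , ¬T) →
          ≺-injection (fibre W d (a ⊖ b ∷ [])) (section representations (a ⊖ b)) (v₀ ∷ [])
            (λ { (a′ ∷ b′ ∷ []) ((Aa′ , Ab′ , _) , q , _) →
              Aa′ , subst (_∈ A) (second a′ b′ (a ⊖ b) q) Ab′ })
            (λ { (a′ ∷ b′ ∷ []) (a″ ∷ b″ ∷ []) (_ , q , _) (_ , q′ , _) eq →
              let a≡ = ∷-injectiveˡ eq
              in cong₂ (λ x y → x ∷ y ∷ []) a≡ (trans (second a′ b′ (a ⊖ b) q)
                (trans (cong (_⊖ (a ⊖ b)) a≡) (sym (second a″ b″ (a ⊖ b) q′)))) })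
            (¬T-unpopular ¬T) }
        where
        d : Vec (Tm 2) 1
        d = (v₀ -ᵗ v₁) ∷ []
        second : ∀ a b t → a ⊖ b ≡ t → b ≡ a ⊖ t
        second a b t eq = trans (solve 2 (λ a b → b := a :- (a :- b)) refl a b) (cong (a ⊖_) eq)

      V⊀ : ¬ V ≺ (102 ℕ.+ e) ℕ.+ (98 ℕ.+ e)
      V⊀ V≺ = ⊀-× A A {100 ℕ.+ e} {100 ℕ.+ e} 0< 0< A⊀ A⊀
        (≺-⊆ (A ×ᶠ A) (W ∨ V) (λ {v} → cover v)
          (subst (W ∨ V ≺_) (sym (move 2 (100 ℕ.+ e) (98 ℕ.+ e))) (≺-∨ W V {(102 ℕ.+ e) ℕ.+ (98 ℕ.+ e)} W≺ V≺)))
        where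
        cover : ∀ v → ⟦ A ×ᶠ A ⟧ v → ⟦ W ∨ V ⟧ v
        cover (a ∷ b ∷ []) (Aa , Ab) with em {P = a ⊖ b ∈ T}
        ... | yes Tt = inj₂ (Aa , Ab , Tt)
        ... | no ¬Tt = inj₁ (Aa , Ab , ¬Tt)

    partners : Carrier → Fm 1
    partners a = A [ v₀ ∷ [] ] ∧ T [ (con a -ᵗ v₀) ∷ [] ]

    abstract
      -- Otherwise projecting `V` to its first coordinate would bound it by (101 + e) + (99 + e) =
      -- 200 + 2e units.
      popular-base : ∃[ a ] a ∈ A × ¬ partners a ≺ 99 ℕ.+ e
      popular-base = em⇒dne em λ ¬p → V⊀ (subst (V ≺_) (move 1 (101 ℕ.+ e) (98 ℕ.+ e))
        (≺-fibres V A (v₀ ∷ []) (λ { (a ∷ b ∷ []) (Aa , _) → Aa }) {99 ℕ.+ e} {101 ℕ.+ e} A≺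
          λ { (a ∷ b ∷ []) (Aa , _) → ≺-injection (fibre V (v₀ ∷ []) (a ∷ [])) (partners a) (v₁ ∷ [])
            (λ { (a′ ∷ b′ ∷ []) ((_ , Ab′ , Tt) , q , _) → Ab′ , subst (λ x → x ⊖ b′ ∈ T) q Tt })
            (λ { (a′ ∷ b′ ∷ []) (a″ ∷ b″ ∷ []) (_ , q , _) (_ , q′ , _) eq →
              cong₂ (λ x y → x ∷ y ∷ []) (trans q (sym q′)) (∷-injectiveˡ eq) })
            (em⇒dne em λ ¬q → ¬p (a , Aa , ¬q)) }))

    -- Adding mT to a set of the form X + A costs at most c units. Uniformity in `X` allows several
    -- multiples of `T` to be added in turn, with the costs summing.
    Absorbed : ℕ → Carrier → Set ℓ
    Absorbed c m = ∀ X {p} → lin 1ᶠ X 1ᶠ A ≺ p → lin 1ᶠ (lin 1ᶠ X m T) 1ᶠ A ≺ c ℕ.+ p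

    absorbed-0 : ∀ c {m} → m ≡ 0ᶠ → Absorbed c m
    absorbed-0 c refl X {p} X+A≺ = ≺-mono _ (ℕₚ.m≤n+m p c)
      (≺-⊆ (lin 1ᶠ (lin 1ᶠ X 0ᶠ T) 1ᶠ A) (lin 1ᶠ X 1ᶠ A)
        (λ { {s ∷ []} (a , u , (t , x , Xx , Tt , x+0t≡u) , Aa , u+a≡s) → a , x , Xx , Aa , trans
          (cong (λ y → 1ᶠ ⊗ y ⊕ 1ᶠ ⊗ a) (trans
            (solve 2 (λ x t → x := 𝟙 :* x :+ int (ℤ.+ 0) :* t) refl x t) x+0t≡u)) u+a≡s })
        X+A≺)

    absorbed-+ : ∀ {c c′ m m′} → Absorbed c m → Absorbed c′ m′ → Absorbed (c′ ℕ.+ c) (m ⊕ m′)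
    absorbed-+ {c} {c′} {m} {m′} h h′ X {p} X+A≺ =
      subst (lin 1ᶠ (lin 1ᶠ X (m ⊕ m′) T) 1ᶠ A ≺_) (sym (ℕₚ.+-assoc c′ c p))
        (≺-⊆ (lin 1ᶠ (lin 1ᶠ X (m ⊕ m′) T) 1ᶠ A) (lin 1ᶠ (lin 1ᶠ (lin 1ᶠ X m T) m′ T) 1ᶠ A)
          (λ { {s ∷ []} (a , u , (t , x , Xx , Tt , x+t≡u) , Aa , u+a≡s) →
            a , u , (t , 1ᶠ ⊗ x ⊕ m ⊗ t , lin-intro 1ᶠ X m T Xx Tt , Tt , trans
              (solve 4 (λ x t m m′ → 𝟙 :* (𝟙 :* x :+ m :* t) :+ m′ :* t := 𝟙 :* x :+ (m :+ m′) :* t)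
                refl x t m m′) x+t≡u) , Aa , u+a≡s })
          (h′ (lin 1ᶠ X m T) (h X X+A≺)))

    -- If z and z - t lie in `A`, then x + yt + a = (x + yz) - (y(z - t) - a); for -y the roles of z
    -- and z - t are exchanged. One unit pays for passing to X + yA, and four for the gap between
    -- 101 + e and the 97 + e units of representations of t.
    absorbed-± : ∀ {y} → Y y → Absorbed 5 y × Absorbed 5 (⊝ y)
    absorbed-± {y} Yy with em {P = y ≡ 0ᶠ}
    ... | yes y≡0 = absorbed-0 5 y≡0 , absorbed-0 5 (trans (cong ⊝_ y≡0) (solve 0 (:- int (ℤ.+ 0) := int (ℤ.+ 0)) refl))
    ... | no y≢0 = plus , minus
      where
      plus : Absorbed 5 y
      plus X {p} X+A≺ = sum-≺ 1ᶠ -1ᶠ (lin 1ᶠ X y A) (lin y A -1ᶠ A) (lin 1ᶠ (lin 1ᶠ X y T) 1ᶠ A)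
        (+yA-≺ Yy X X+A≺) (yA-A≺ Yy) (move 4 (1 ℕ.+ p) (97 ℕ.+ e)) 0< (0< {96 ℕ.+ e})
        λ s (a , u , (t , x , Xx , Tt , x+yt≡u) , Aa , u+a≡s) →
          section representations t , T-popular Tt ,
          con 1ᶠ *ᵗ con x +ᵗ con y *ᵗ v₀ , con y *ᵗ (v₀ -ᵗ con t) +ᵗ con -1ᶠ *ᵗ con a ,
          (λ z w eq → *-cancelˡ y≢0 (+-cancelˡ (1ᶠ ⊗ x) eq)) ,
          (λ z (Az , Az-t) → lin-intro 1ᶠ X y A Xx Az , lin-intro y A -1ᶠ A Az-t Aa , trans (solve 5 (λ x y a t z →
            𝟙 :* (𝟙 :* x :+ y :* z) :+ -𝟙 :* (y :* (z :- t) :+ -𝟙 :* a)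
              := 𝟙 :* (𝟙 :* x :+ y :* t) :+ 𝟙 :* a) refl x y a t z)
            (trans (cong (λ w → 1ᶠ ⊗ w ⊕ 1ᶠ ⊗ a) x+yt≡u) u+a≡s))
      minus : Absorbed 5 (⊝ y)
      minus X {p} X+A≺ = sum-≺ 1ᶠ -1ᶠ (lin 1ᶠ X y A) (lin y A -1ᶠ A) (lin 1ᶠ (lin 1ᶠ X (⊝ y) T) 1ᶠ A)
        (+yA-≺ Yy X X+A≺) (yA-A≺ Yy) (move 4 (1 ℕ.+ p) (97 ℕ.+ e)) 0< (0< {96 ℕ.+ e})
        λ s (a , u , (t , x , Xx , Tt , x-yt≡u) , Aa , u+a≡s) →
          section representations t , T-popular Tt ,
          con 1ᶠ *ᵗ con x +ᵗ con y *ᵗ (v₀ -ᵗ con t) , con y *ᵗ v₀ +ᵗ con -1ᶠ *ᵗ con a ,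
          (λ z w eq → +-cancelʳ (⊝ t) (*-cancelˡ y≢0 (+-cancelˡ (1ᶠ ⊗ x) eq))) ,
          (λ z (Az , Az-t) → lin-intro 1ᶠ X y A Xx Az-t , lin-intro y A -1ᶠ A Az Aa , trans (solve 5 (λ x y a t z →
            𝟙 :* (𝟙 :* x :+ y :* (z :- t)) :+ -𝟙 :* (y :* z :+ -𝟙 :* a)
              := 𝟙 :* (𝟙 :* x :+ :- y :* t) :+ 𝟙 :* a) refl x y a t z)
            (trans (cong (λ w → 1ᶠ ⊗ w ⊕ 1ᶠ ⊗ a) x-yt≡u) u+a≡s))

    -- X + ymT + yA = y(X/y + mT + A), and exchanging A for yA and back costs one unit each time.
    absorbed-* : ∀ {y c m} → Y y → Absorbed c m → Absorbed (2 ℕ.+ c) (y ⊗ m)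
    absorbed-* {y} {c} {m} Yy h with em {P = y ≡ 0ᶠ}
    ... | yes y≡0 = absorbed-0 (2 ℕ.+ c) (trans (cong (_⊗ m) y≡0) (zeroˡ m))
    ... | no y≢0 = λ X {p} X+A≺ → subst (lin 1ᶠ (lin 1ᶠ X (y ⊗ m) T) 1ᶠ A ≺_) (cong suc (ℕₚ.+-suc c p))
        (+A-≺ Yy y≢0 (lin 1ᶠ X (y ⊗ m) T) (scale-back X (h (X/y X) (scale X (+yA-≺ Yy X X+A≺)))))
      where
      y⁻¹ = proj₁ (inverse y y≢0)
      yy⁻¹≡1 = proj₂ (inverse y y≢0)
      y⁻¹≢0 : y⁻¹ ≢ 0ᶠ
      y⁻¹≢0 y⁻¹≡0 = 1≢0 (trans (sym yy⁻¹≡1) (trans (cong (y ⊗_) y⁻¹≡0) (zeroʳ y)))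
      X/y : Fm 1 → Fm 1
      X/y X = X [ (con y *ᵗ v₀) ∷ [] ]
      undo : ∀ x → y ⊗ (y⁻¹ ⊗ x) ≡ x
      undo x = trans (sym (*-assoc y y⁻¹ x)) (trans (cong (_⊗ x) yy⁻¹≡1) (*-identityˡ x))
      scale : ∀ X {p} → lin 1ᶠ X y A ≺ p → lin 1ᶠ (X/y X) 1ᶠ A ≺ p
      scale X = ≺-injection (lin 1ᶠ (X/y X) 1ᶠ A) (lin 1ᶠ X y A) ((con y *ᵗ v₀) ∷ [])
        (λ { (s ∷ []) (a , x , Xx , Aa , x+a≡s) → a , y ⊗ x , Xx , Aa , trans
          (solve 3 (λ x y a → 𝟙 :* (y :* x) :+ y :* a := y :* (𝟙 :* x :+ 𝟙 :* a)) refl x y a)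
          (cong (y ⊗_) x+a≡s) })
        (λ { (s ∷ []) (s′ ∷ []) _ _ eq → cong (_∷ []) (*-cancelˡ y≢0 (∷-injectiveˡ eq)) })
      scale-back : ∀ X {p} → lin 1ᶠ (lin 1ᶠ (X/y X) m T) 1ᶠ A ≺ p → lin 1ᶠ (lin 1ᶠ X (y ⊗ m) T) y A ≺ p
      scale-back X = ≺-injection (lin 1ᶠ (lin 1ᶠ X (y ⊗ m) T) y A) (lin 1ᶠ (lin 1ᶠ (X/y X) m T) 1ᶠ A)
        ((con y⁻¹ *ᵗ v₀) ∷ [])
        (λ { (s ∷ []) (a , u , (t , x , Xx , Tt , x+ymt≡u) , Aa , u+ya≡s) →
          a , 1ᶠ ⊗ (y⁻¹ ⊗ x) ⊕ m ⊗ t ,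
          lin-intro 1ᶠ (X/y X) m T (subst (_∈ X) (sym (undo x)) Xx) Tt , Aa ,
          *-cancelˡ y≢0 (trans
            (solve 6 (λ x y y⁻¹ m t a → y :* (𝟙 :* (𝟙 :* (y⁻¹ :* x) :+ m :* t) :+ 𝟙 :* a)
              := 𝟙 :* (𝟙 :* (y :* (y⁻¹ :* x)) :+ (y :* m) :* t) :+ y :* a) refl x y y⁻¹ m t a)
            (trans (cong (λ x → 1ᶠ ⊗ (1ᶠ ⊗ x ⊕ (y ⊗ m) ⊗ t) ⊕ y ⊗ a) (undo x))
              (trans (cong (λ w → 1ᶠ ⊗ w ⊕ y ⊗ a) x+ymt≡u) (trans u+ya≡s (sym (undo s)))))) })
        (λ { (s ∷ []) (s′ ∷ []) _ _ eq → cong (_∷ []) (*-cancelˡ y⁻¹≢0 (∷-injectiveˡ eq)) })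

    -- Both signs are carried along: multipliers are built from differences of elements of Y, and
    -- `Σ-set` uses the negated multipliers.
    Cheap : ℕ → Carrier → Set ℓ
    Cheap c m = Absorbed c m × Absorbed c (⊝ m)

    cheap-+ : ∀ {c c′ m m′} → Cheap c m → Cheap c′ m′ → Cheap (c′ ℕ.+ c) (m ⊕ m′)
    cheap-+ {c} {c′} {m} {m′} (h , -h) (h′ , -h′) = absorbed-+ h h′ ,
      subst (Absorbed (c′ ℕ.+ c)) (solve 2 (λ m m′ → :- m :+ :- m′ := :- (m :+ m′)) refl m m′)
        (absorbed-+ -h -h′)

    cheap-neg : ∀ {c m} → Cheap c m → Cheap c (⊝ m)
    cheap-neg {c} {m} (h , -h) = -h , subst (Absorbed c) (solve 1 (λ m → m := :- (:- m)) refl m) h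

    cheap-* : ∀ {y c m} → Y y → Cheap c m → Cheap (2 ℕ.+ c) (y ⊗ m)
    cheap-* {y} {c} {m} Yy (h , -h) = absorbed-* Yy h ,
      subst (Absorbed (2 ℕ.+ c)) (solve 2 (λ y m → y :* :- m := :- (y :* m)) refl y m) (absorbed-* Yy -h)

    cheap-difference : ∀ {x y} → Y x → Y y → Cheap 10 (x ⊖ y)
    cheap-difference Yx Yy = cheap-+ (absorbed-± Yx) (cheap-neg (absorbed-± Yy))

    -- Only multiplication by elements of Y is available, so (x - y)m is expanded as xm + y(-m).
    cheap-difference-* : ∀ {x y c m} → Y x → Y y → Cheap c m → Cheap ((2 ℕ.+ c) ℕ.+ (2 ℕ.+ c)) ((x ⊖ y) ⊗ m)
    cheap-difference-* {x} {y} {c} {m} Yx Yy h = subst (Cheap ((2 ℕ.+ c) ℕ.+ (2 ℕ.+ c)))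
      (solve 3 (λ x y m → x :* m :+ y :* :- m := (x :- y) :* m) refl x y m)
      (cheap-+ (cheap-* Yx h) (cheap-* Yy (cheap-neg h)))

    -- Quotients with many representations

    ratios : Fm 2
    ratios = Δ [ v₀ ∷ [] ] ∧ neg (v₀ == con 0ᶠ) ∧ Δ [ (v₁ *ᵗ v₀) ∷ [] ]

    private
      origin : Fm 1
      origin = v₀ == con 0ᶠ

      origin≺ : ∀ {k} → 0 ℕ.< k → origin ≺ k
      origin≺ 0<k = ≺-finite origin 0<k ((0ᶠ ∷ []) List.∷ List.[] , λ { {x ∷ []} refl → here refl })

    -- The bound 72 is the cost of the sum of two quotients, the dearest case needed.
    module _ {c c′ r N D} (cheap-N : Cheap c N) (cheap-D : Cheap c′ D) (c+c′≤72 : c ℕ.+ c′ ℕ.≤ 72)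
      (D≢0 : D ≢ 0ᶠ) (rD≡N : r ⊗ D ≡ N) where

      private
        a₀ : Carrier
        a₀ = proj₁ popular-base

        P : Fm 1
        P = partners a₀

        -- This is -DT - NT + A. It starts from X = {0}, for which X + A = A has fewer than 101 + e
        -- units; absorbing D and N adds at most 72.
        Σ-set : Fm 1
        Σ-set = lin 1ᶠ (lin 1ᶠ (lin 1ᶠ origin (⊝ D) T) (⊝ N) T) 1ᶠ A

        Σ≺ : Σ-set ≺ 173 ℕ.+ e
        Σ≺ = ≺-mono Σ-set (subst (ℕ._≤ 173 ℕ.+ e) (ℕₚ.+-assoc c c′ (101 ℕ.+ e))
            (ℕₚ.+-monoˡ-≤ (101 ℕ.+ e) c+c′≤72))
          (proj₂ cheap-N (lin 1ᶠ origin (⊝ D) T) (proj₂ cheap-D origin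
            (≺-⊆ (lin 1ᶠ origin 1ᶠ A) A (λ { {s ∷ []} (a , x , refl , Aa , a≡s) → subst (_∈ A)
              (trans (solve 1 (λ a → a := 𝟙 :* int (ℤ.+ 0) :+ 𝟙 :* a) refl a) a≡s) Aa }) A≺)))

        -- The value at (b , b′) is a₀ - D(a₀ - b) - N(a₀ - b′), that is, Db + Nb′ up to a constant.
        -- The factors 1 and the summand 0 match the shape of `lin`.
        f : Tm 2
        f = con 1ᶠ *ᵗ (con 1ᶠ *ᵗ (con 1ᶠ *ᵗ con 0ᶠ +ᵗ con (⊝ D) *ᵗ (con a₀ -ᵗ v₀))
              +ᵗ con (⊝ N) *ᵗ (con a₀ -ᵗ v₁)) +ᵗ con 1ᶠ *ᵗ con a₀

        f-maps : ∀ v → ⟦ P ×ᶠ P ⟧ v → ⟦ Σ-set ⟧ (⟦ f ∷ [] ⟧* v)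
        f-maps (b ∷ b′ ∷ []) ((Ab , Tb) , (Ab′ , Tb′)) =
          lin-intro 1ᶠ (lin 1ᶠ (lin 1ᶠ origin (⊝ D) T) (⊝ N) T) 1ᶠ A
            (lin-intro 1ᶠ (lin 1ᶠ origin (⊝ D) T) (⊝ N) T
              (lin-intro 1ᶠ origin (⊝ D) T refl Tb) Tb′) (proj₁ (proj₂ popular-base))

        -- Equal values mean Db + Nb′ = Dd + Nd′; dividing by D turns N into r.
        relation : ∀ {b b′ d d′} → ⟦ f ⟧ₜ (b ∷ b′ ∷ []) ≡ ⟦ f ⟧ₜ (d ∷ d′ ∷ []) → r ⊗ (b′ ⊖ d′) ≡ d ⊖ b
        relation {b} {b′} {d} {d′} eq = x-y≡0⇒x≡y (*-cancelˡ D≢0 (trans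
          (solve 8 (λ r D N a b b′ d d′ →
            D :* (r :* (b′ :- d′) :- (d :- b)) :=
              ((r :* D :- N) :* (b′ :- d′)) :+ (val N D a b b′ :- val N D a d d′)) refl r D N a₀ b b′ d d′)
          (trans (cong₂ _⊕_ (trans (cong (λ x → (x ⊖ N) ⊗ (b′ ⊖ d′)) rD≡N)
              (solve 3 (λ N b d → (N :- N) :* (b :- d) := int (ℤ.+ 0)) refl N b′ d′))
            (trans (cong (_⊖ ⟦ f ⟧ₜ (d ∷ d′ ∷ [])) eq) (-‿inverseʳ (⟦ f ⟧ₜ (d ∷ d′ ∷ [])))))
            (solve 1 (λ D → int (ℤ.+ 0) :+ int (ℤ.+ 0) := D :* int (ℤ.+ 0)) refl D))))
          where
          val : ∀ {n} (N D a b b′ : Polynomial n) → Polynomial n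
          val N D a b b′ = 𝟙 :* (𝟙 :* (𝟙 :* int (ℤ.+ 0) :+ :- D :* (a :- b)) :+ :- N :* (a :- b′)) :+ 𝟙 :* a

        abstract
          -- P × P has at least 198 + 2e units and is mapped into a set of fewer than 173 + e, so
          -- some fibre keeps 25 + e.
          large-fibre : ∃[ v ] ⟦ P ×ᶠ P ⟧ v × ¬ fibre (P ×ᶠ P) (f ∷ []) (⟦ f ∷ [] ⟧* v) ≺ 25 ℕ.+ e
          large-fibre = em⇒dne em λ ¬p → ⊀-× P P {99 ℕ.+ e} {99 ℕ.+ e} 0< 0< (proj₂ (proj₂ popular-base)) (proj₂ (proj₂ popular-base))
            (subst (P ×ᶠ P ≺_) (sym (move 74 (99 ℕ.+ e) (25 ℕ.+ e)))
              (≺-fibres (P ×ᶠ P) Σ-set (f ∷ []) f-maps Σ≺ λ v Pv → em⇒dne em λ ¬q → ¬p (v , Pv , ¬q)))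

      -- In a large fibre through (d , d′) the entry b′ determines b, so (b , b′) ↦ b′ - d′ is
      -- injective there. By `relation` its nonzero values lie in the section of `ratios` at r; the
      -- value 0 is covered by `origin`, of dimension 0.
      ratios-large : ¬ section ratios r ≺ 25 ℕ.+ e
      ratios-large Z≺ with large-fibre
      ... | (d ∷ d′ ∷ []) , ((Ad , _) , (Ad′ , _)) , fib⊀ = fib⊀
        (≺-injection (fibre (P ×ᶠ P) (f ∷ []) (⟦ f ∷ [] ⟧* (d ∷ d′ ∷ []))) (section ratios r ∨ origin)
          ((v₁ -ᵗ con d′) ∷ [])
          (λ { (b ∷ b′ ∷ []) (((Ab , _) , (Ab′ , _)) , eq , _) → member Ab Ab′ eq })
          (λ { (b ∷ b′ ∷ []) (c ∷ c′ ∷ []) (_ , eq , _) (_ , eq′ , _) s → inj (trans eq (sym eq′))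
            (+-cancelʳ (⊝ d′) (∷-injectiveˡ s)) })
          (≺-∨ (section ratios r) origin Z≺ (origin≺ 0<)))
        where
        member : ∀ {b b′} → b ∈ A → b′ ∈ A → ⟦ f ⟧ₜ (b ∷ b′ ∷ []) ≡ ⟦ f ⟧ₜ (d ∷ d′ ∷ []) →
                 b′ ⊖ d′ ∈ section ratios r ∨ origin
        member {b} {b′} Ab Ab′ eq with em {P = b′ ⊖ d′ ≡ 0ᶠ}
        ... | yes z = inj₂ z
        ... | no ¬z = inj₁ (Δ-intro Ab′ Ad′ , ¬z , subst (_∈ Δ) (sym (relation eq)) (Δ-intro Ad Ab))
        inj : ∀ {b b′ c c′} → ⟦ f ⟧ₜ (b ∷ b′ ∷ []) ≡ ⟦ f ⟧ₜ (c ∷ c′ ∷ []) → b′ ≡ c′ →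
              _≡_ {A = Vec Carrier 2} (b ∷ b′ ∷ []) (c ∷ c′ ∷ [])
        inj {b} {b′} {c} eq refl = cong (λ x → x ∷ b′ ∷ []) (sym (x-y≡0⇒x≡y (trans (sym (relation eq))
          (solve 2 (λ r b → r :* (b :- b) := int (ℤ.+ 0)) refl r b′))))

      ratio-in-A : DifferenceQuotient A r
      ratio-in-A with ⊀⇒satisfiable (section ratios r) 0< ratios-large
      ... | z ∷ [] , (y , x , Ax , Ay , refl) , z≢0 , (b , a , Aa , Ab , ez) =
        a , b , x , y , Aa , Ab , Ax , Ay , (λ x-y≡0 → z≢0 (trans (minus x y) x-y≡0)) ,
        trans (cong (r ⊗_) (sym (minus x y))) (trans (sym ez) (minus a b))
        where
        minus : ∀ x y → 1ᶠ ⊗ x ⊕ -1ᶠ ⊗ y ≡ x ⊖ y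
        minus = solve 2 (λ x y → 𝟙 :* x :+ -𝟙 :* y := x :- y) refl

    private
      many-ratios = threshold ratios (24 ℕ.+ e)

    abstract
      E : Fm 1
      E = proj₁ many-ratios

      E-intro : ∀ {r} → ¬ section ratios r ≺ 25 ℕ.+ e → r ∈ E
      E-intro {r} = proj₁ (proj₂ many-ratios) r

      E-elim : ∀ {r} → r ∈ E → ¬ section ratios r ≺ 24 ℕ.+ e
      E-elim {r} = proj₂ (proj₂ many-ratios) r

    -- Pairs (r , z) embed in Δ × Δ as (z , rz), because z is nonzero, and so have fewer than 204 +
    -- 2e units. Each r in `E` accounts for at least 24 + e of them.
    E≺ : E ≺ 180 ℕ.+ e
    E≺ = ≺-fibres⁻ X E (v₀ ∷ []) (λ { (r ∷ z ∷ []) (Er , _) → Er }) surj {24 ℕ.+ e} 0< X≺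
      (λ { (r ∷ []) Er fib≺ → E-elim Er (≺-injection (section ratios r) (fibre X (v₀ ∷ []) (r ∷ []))
        (con r ∷ v₀ ∷ [])
        (λ { (z ∷ []) Zz → (Er , Zz) , refl , refl })
        (λ { (z ∷ []) (w ∷ []) _ _ eq → proj₂ (∷-injective eq) }) fib≺) })
      where
      X : Fm 2
      X = E [ v₀ ∷ [] ] ∧ ratios [ v₁ ∷ v₀ ∷ [] ]
      surj : ∀ w → ⟦ E ⟧ w → ∃[ v ] ⟦ X ⟧ v × ⟦ v₀ ∷ [] ⟧* v ≡ w
      surj (r ∷ []) Er with ⊀⇒satisfiable (section ratios r) 0< (E-elim Er)
      ... | z ∷ [] , Zz = r ∷ z ∷ [] , (Er , Zz) , refl
      X≺ : X ≺ (180 ℕ.+ e) ℕ.+ (24 ℕ.+ e)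
      X≺ = subst (X ≺_) (move 78 (102 ℕ.+ e) (24 ℕ.+ e))
        (≺-injection X (Δ ×ᶠ Δ) (v₁ ∷ (v₀ *ᵗ v₁) ∷ [])
          (λ { (r ∷ z ∷ []) (_ , Δz , _ , Δrz) → Δz , Δrz })
          (λ { (r ∷ z ∷ []) (r′ ∷ z′ ∷ []) (_ , _ , z≢0 , _) _ eq → inj z≢0 (∷-injectiveˡ eq)
            (∷-injectiveˡ (proj₂ (∷-injective eq))) })
          (≺-× Δ Δ Δ≺ Δ≺))
        where
        inj : ∀ {r z r′ z′} → z ≢ 0ᶠ → z ≡ z′ → r ⊗ z ≡ r′ ⊗ z′ →
              _≡_ {A = Vec Carrier 2} (r ∷ z ∷ []) (r′ ∷ z′ ∷ [])
        inj {r} {z} {r′} z≢0 refl eq = cong (_∷ z ∷ [])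
          (*-cancelˡ z≢0 (trans (*-comm z r) (trans eq (*-comm r′ z))))

-- The field of quotients of differences

module DifferenceQuotients (em : ∀ {a} → ExcludedMiddle a) {ℓ} {L : Language ℓ} (S : RingSymbols L)
  (F : Structure L) (isField : FieldOps.IsField S F) {K : Set ℓ} (ℕ↣K : ℕ ↣ K)
  (saturated : Saturated F K) (dim : Dimension F)
  (Y : Pred (Structure.Carrier F) ℓ) (params : K → Structure.Carrier F) (Γ : Pred (FormulaOver L K 1) ℓ)
  (Y≐Γ : FieldOps.⌜_⌝ S F Y ≐ Realizes F params Γ) where

  open Structure F
  open Dimension dim
  open FieldOps S F
  open FieldTheory S F isField
  open DimensionTheory em S F dim
  open FieldFormulas em S F dim
  open Compactness em S F ℕ↣K saturated Y params Γ Y≐Γ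

  private
    d : ℝ≥0∞ ℓ
    d = δᵗ ⌜ Y ⌝

    Q : Pred Carrier ℓ
    Q = (Y -ˢ Y) /ˢ (Y -ˢ Y)

  quotient : ∀ {z a b x y} → Y a → Y b → Y x → Y y → x ⊖ y ≢ 0ᶠ → z ⊗ (x ⊖ y) ≡ a ⊖ b → Q z
  quotient Ya Yb Yx Yy x-y≢0 e =
    _ , _ , (_ , _ , Ya , Yb , refl) , (_ , _ , Yx , Yy , refl) , x-y≢0 , e

  -- If no four elements of Y represented z, then by compactness no four elements of some `Φ i`
  -- would.
  quotient-in-all : ∀ z → (∀ i → DifferenceQuotient (Φ i) z) → Q z
  quotient-in-all z in-all with em {P = Q z}
  ... | yes Qz = Qz
  ... | no ¬Qz =
    let i , Φ⇒R = compactness R λ { (a ∷ b ∷ x ∷ y ∷ []) Yv (x-y≢0 , e) →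
          ¬Qz (quotient (Yv zero) (Yv (suc zero)) (Yv (suc (suc zero))) (Yv (suc (suc (suc zero)))) x-y≢0 e) }
        a , b , x , y , Φa , Φb , Φx , Φy , x-y≢0 , e = in-all i
    in ⊥-elim (Φ⇒R (a ∷ b ∷ x ∷ y ∷ [])
      (λ { zero → Φa ; (suc zero) → Φb ; (suc (suc zero)) → Φx ; (suc (suc (suc zero))) → Φy })
      (x-y≢0 , e))
    where
    R : Fm 4
    R = neg (neg (w₂ -ᵗ w₃ == con 0ᶠ) ∧ con z *ᵗ (w₂ -ᵗ w₃) == w₀ -ᵗ w₁)
      where
      w₀ = var zero
      w₁ = var (suc zero)
      w₂ = var (suc (suc zero))
      w₃ = var (suc (suc (suc zero)))

  module Scale (YY-Y≤Y : δᵗ ⌜ Y *ˢ Y -ˢ Y ⌝ ≤ δᵗ ⌜ Y ⌝) {y₁ y₂} (Yy₁ : Y y₁) (Yy₂ : Y y₂)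
    (y₁-y₂≢0 : y₁ ⊖ y₂ ≢ 0ᶠ) {ε : ℚ} (0<ε : 0ℚ ℚ.< ε) (e : ℕ)
    (lower : ¬ cut (δᵗ ⌜ Y ⌝) ((100 ℕ.+ e) ∙ ε)) (higher : cut (δᵗ ⌜ Y ⌝) (suc (100 ℕ.+ e) ∙ ε)) where

    open Counting 0<ε
    open FieldCounting em S F isField dim 0<ε using (difference-quotient; module SmallDoubling)

    ⊇Y⊀ : ∀ n → ¬ cut d (n ∙ ε) → ∀ φ → (∀ {y} → Y y → y ∈ φ) → ¬ φ ≺ n
    ⊇Y⊀ n n≤d φ Y⊆φ ⟨ c ⟩ = n≤d (∣∣⇒δᵗ φ (λ { {y ∷ []} Yy → Y⊆φ Yy }) c)

    abstract
      -- One conjunction lies in a formula witnessing that Y is small. On another, all xy - z lie in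
      -- a formula witnessing the same for YY - Y; this one also contains the multipliers from Y.
      -- The index `j` joins both with `i`.
      small-index : ∀ n → cut d (n ∙ ε) → ∀ i → ∃[ j ] ⟦ Φ j ⟧ ⊆ ⟦ Φ i ⟧ × Φ j ≺ n ×
                    (∀ {y} → Y y → lin y (Φ j) -1ᶠ (Φ j) ≺ n)
      small-index n d<n i with δᵗ⇒∣∣ d<n | δᵗ⇒∣∣ (YY-Y≤Y d<n)
      ... | φ , Y⊆φ , φ< | ψ , YY-Y⊆ψ , ψ<
        with compactness φ (λ { (y ∷ []) Yv → Y⊆φ (Yv zero) })
           | compactness R (λ { (x ∷ y ∷ z ∷ []) Yv →
               YY-Y⊆ψ (_ , _ , (_ , _ , Yv zero , Yv (suc zero) , refl) , Yv (suc (suc zero)) , refl) })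
        where
        R : Fm 3
        R = ψ [ (var zero *ᵗ var (suc zero) -ᵗ var (suc (suc zero))) ∷ [] ]
      ... | i₁ , Φ⊆φ | i₂ , Φ⊆R = j , Φj⊆Φi ,
        ≺-⊆ (Φ j) φ (λ { {x ∷ []} Φx → Φ⊆φ (x ∷ []) (λ { zero → Φj⊆Φi₁ Φx }) }) ⟨ φ< ⟩ ,
        λ {y} Yy → ≺-⊆ (lin y (Φ j) -1ᶠ (Φ j)) ψ
          (λ { {s ∷ []} (z , x , Φx , Φz , refl) →
            subst (_∈ ψ) (solve 3 (λ x y z → y :* x :- z := y :* x :+ -𝟙 :* z) refl x y z)
              (Φ⊆R (y ∷ x ∷ z ∷ []) (λ { zero → Y⊆Φ i₂ Yy ; (suc zero) → Φj⊆Φi₂ Φx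
                                       ; (suc (suc zero)) → Φj⊆Φi₂ Φz })) }) ⟨ ψ< ⟩
        where
        j : Index
        j = i₁ List.++ (i₂ List.++ i)
        Φj⊆Φi₁ : ⟦ Φ j ⟧ ⊆ ⟦ Φ i₁ ⟧
        Φj⊆Φi₁ = Φ-++ˡ i₁ _
        Φj⊆Φi₂ : ⟦ Φ j ⟧ ⊆ ⟦ Φ i₂ ⟧
        Φj⊆Φi₂ p = Φ-++ˡ i₂ i (Φ-++ʳ i₁ _ p)
        Φj⊆Φi : ⟦ Φ j ⟧ ⊆ ⟦ Φ i ⟧
        Φj⊆Φi p = Φ-++ʳ i₂ i (Φ-++ʳ i₁ _ p)

    nonzero : ∃[ y ] Y y × y ≢ 0ᶠ
    nonzero with em {P = y₁ ≡ 0ᶠ} | em {P = y₂ ≡ 0ᶠ}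
    ... | no y₁≢0 | _ = y₁ , Yy₁ , y₁≢0
    ... | yes _ | no y₂≢0 = y₂ , Yy₂ , y₂≢0
    ... | yes refl | yes refl = ⊥-elim (y₁-y₂≢0 (-‿inverseʳ 0ᶠ))

    module At (i : Index) where
      j = proj₁ (small-index (suc (100 ℕ.+ e)) higher i)
      Φj⊆Φi = proj₁ (proj₂ (small-index (suc (100 ℕ.+ e)) higher i))

      open SmallDoubling e Y (Φ j) (⊇Y⊀ (100 ℕ.+ e) lower (Φ j) (Y⊆Φ j))
        (proj₁ (proj₂ (proj₂ (small-index (suc (100 ℕ.+ e)) higher i))))
        (proj₂ (proj₂ (proj₂ (small-index (suc (100 ℕ.+ e)) higher i))))
        (proj₁ (proj₂ nonzero)) (proj₂ (proj₂ nonzero)) public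

      fraction : ∀ {c c′ r N D} → Cheap c N → Cheap c′ D → c ℕ.+ c′ ℕ.≤ 72 → D ≢ 0ᶠ → r ⊗ D ≡ N →
        DifferenceQuotient (Φ i) r
      fraction {r = r} N D c D≢0 rD≡N = difference-quotient-mono {Φ j} {Φ i} {r} Φj⊆Φi (ratio-in-A N D c D≢0 rD≡N)

    module Top = At List.[]

    Q⊆E : ∀ {z} → Q z → z ∈ Top.E
    Q⊆E (_ , _ , (a , b , Ya , Yb , refl) , (x , y , Yx , Yy , refl) , x-y≢0 , e) =
      -- Each difference of elements of Y costs 10.
      Top.E-intro (Top.ratios-large (Top.cheap-difference Ya Yb) (Top.cheap-difference Yx Yy)
        (ℕₚ.m≤m+n 20 52) x-y≢0 e)

    -- Write y as y(y₁ - y₂) / (y₁ - y₂), with numerator of cost 12.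
    Y⊆Q : ∀ {y} → Y y → Q y
    Y⊆Q {y} Yy = quotient-in-all y λ i → let open At i in
      fraction (cheap-* Yy (cheap-difference Yy₁ Yy₂)) (cheap-difference Yy₁ Yy₂)
        (ℕₚ.m≤m+n 22 50) y₁-y₂≢0 refl

    Q-+ : ∀ {r s} → Q r → Q s → Q (r ⊕ s)
    Q-+ {r} {s} (_ , _ , (a , b , Ya , Yb , refl) , (x , y , Yx , Yy , refl) , x-y≢0 , e)
      (_ , _ , (a′ , b′ , Ya′ , Yb′ , refl) , (x′ , y′ , Yx′ , Yy′ , refl) , x′-y′≢0 , e′) =
      quotient-in-all (r ⊕ s) λ i → let open At i in
        -- A product of two differences costs 24; over the common denominator the numerator has two
        -- such products.
        fraction {c = 48} {c′ = 24}
          (cheap-+ (cheap-difference-* Ya Yb (cheap-difference Yx′ Yy′))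
                   (cheap-difference-* Ya′ Yb′ (cheap-difference Yx Yy)))
          (cheap-difference-* Yx Yy (cheap-difference Yx′ Yy′)) ℕₚ.≤-refl
          (*-nonzero x-y≢0 x′-y′≢0)
          (trans (solve 4 (λ r s p p′ → (r :+ s) :* (p :* p′) := (r :* p) :* p′ :+ (s :* p′) :* p)
              refl r s (x ⊖ y) (x′ ⊖ y′))
            (cong₂ (λ n n′ → n ⊗ (x′ ⊖ y′) ⊕ n′ ⊗ (x ⊖ y)) e e′))

    Q-* : ∀ {r s} → Q r → Q s → Q (r ⊗ s)
    Q-* {r} {s} (_ , _ , (a , b , Ya , Yb , refl) , (x , y , Yx , Yy , refl) , x-y≢0 , e)
      (_ , _ , (a′ , b′ , Ya′ , Yb′ , refl) , (x′ , y′ , Yx′ , Yy′ , refl) , x′-y′≢0 , e′) =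
      quotient-in-all (r ⊗ s) λ i → let open At i in
        fraction
          (cheap-difference-* Ya Yb (cheap-difference Ya′ Yb′))
          (cheap-difference-* Yx Yy (cheap-difference Yx′ Yy′)) (ℕₚ.m≤m+n 48 24)
          (*-nonzero x-y≢0 x′-y′≢0)
          (trans (solve 4 (λ r s p p′ → (r :* s) :* (p :* p′) := (r :* p) :* (s :* p′))
              refl r s (x ⊖ y) (x′ ⊖ y′))
            (cong₂ _⊗_ e e′))

    Q-subfield : IsSubfield Q
    Q-subfield = record
      { 0∈ = quotient Yy₁ Yy₁ Yy₁ Yy₂ y₁-y₂≢0
          (solve 2 (λ x y → int (ℤ.+ 0) :* (x :- y) := x :- x) refl y₁ y₂)
      ; 1∈ = quotient Yy₁ Yy₂ Yy₁ Yy₂ y₁-y₂≢0 (*-identityˡ _)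
      ; +-closed = Q-+
      ; neg-closed = λ { {z} (_ , _ , (a , b , Ya , Yb , refl) , (x , y , Yx , Yy , refl) , x-y≢0 , e) →
          quotient Yb Ya Yx Yy x-y≢0
            (trans (solve 2 (λ z p → :- z :* p := :- (z :* p)) refl z (x ⊖ y))
              (trans (cong ⊝_ e) (solve 2 (λ a b → :- (a :- b) := b :- a) refl a b))) }
      ; *-closed = Q-*
      ; inv-closed = λ { {z} {w} (_ , _ , (a , b , Ya , Yb , refl) , (x , y , Yx , Yy , refl) , x-y≢0 , e) zw≡1 →
          let w[a-b]≡x-y : w ⊗ (a ⊖ b) ≡ x ⊖ y
              w[a-b]≡x-y = trans (cong (w ⊗_) (sym e))
                (trans (solve 3 (λ w z p → w :* (z :* p) := (z :* w) :* p) refl w z (x ⊖ y))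
                  (trans (cong (_⊗ (x ⊖ y)) zw≡1) (*-identityˡ _)))
          in quotient Yx Yy Ya Yb
            (λ a-b≡0 → x-y≢0 (trans (sym w[a-b]≡x-y) (trans (cong (w ⊗_) a-b≡0) (zeroʳ w)))) w[a-b]≡x-y }
      }

    -- Definability of Q

    private
      w : ∀ {n} (i : Fin 7) → Tm (7 ℕ.+ n)
      w {n} i = var (i Fin.↑ˡ n)

      -- b + z b′ ∈ E for every quotient z = (a - c) / (x - y).
      R : Fm 6
      R = neg (ex (neg (x -ᵗ y == con 0ᶠ) ∧ z *ᵗ (x -ᵗ y) == a -ᵗ c ∧ neg (Top.E [ (b +ᵗ z *ᵗ b′) ∷ [] ])))
        where
        z  = w {0} zero
        b  = w {0} (suc zero)
        b′ = w {0} (suc (suc zero))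
        a  = w {0} (suc (suc (suc zero)))
        c  = w {0} (suc (suc (suc (suc zero))))
        x  = w {0} (suc (suc (suc (suc (suc zero)))))
        y  = w {0} (suc (suc (suc (suc (suc (suc zero))))))

      Φ⇒R = compactness R λ { (b ∷ b′ ∷ a ∷ c ∷ x ∷ y ∷ []) Yv (z , x-y≢0 , eq , ¬E) →
        ¬E (Q⊆E (Q-+ (Y⊆Q (Yv zero)) (Q-* (quotient (Yv (suc (suc zero))) (Yv (suc (suc (suc zero))))
          (Yv (suc (suc (suc (suc zero))))) (Yv (suc (suc (suc (suc (suc zero)))))) x-y≢0 eq)
          (Y⊆Q (Yv (suc zero)))))) }

      i₀ = proj₁ Φ⇒R

      -- Here it matters that d has at least 100 units: the 180 + e units of `E` do not exceed twice
      -- 100 + e.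
      180+e≤ : ∀ e → 180 ℕ.+ e ℕ.≤ (100 ℕ.+ e) ℕ.+ (100 ℕ.+ e)
      180+e≤ e = ℕₚ.+-mono-≤ {100} {100 ℕ.+ e} {80 ℕ.+ e} {100 ℕ.+ e} (ℕₚ.m≤m+n 100 e) (ℕₚ.m≤n+m (80 ℕ.+ e) 20)

    Q-formula : Fm 1
    Q-formula = ex (ex (ex (ex (Φ i₀ [ a ∷ [] ] ∧ Φ i₀ [ b ∷ [] ] ∧ Φ i₀ [ x ∷ [] ] ∧ Φ i₀ [ y ∷ [] ] ∧
      neg (x -ᵗ y == con 0ᶠ) ∧ z *ᵗ (x -ᵗ y) == a -ᵗ b))))
      where
      y = var zero
      x = var (suc zero)
      b = var (suc (suc zero))
      a = var (suc (suc (suc zero)))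
      z = var (suc (suc (suc (suc zero))))

    -- Let z be a quotient of differences of `Φ i₀`. For any i, the choice of `i₀` gives C + zC ⊆ E
    -- for C = `Φ (i ++ i₀)`, and `E` is too small for an injective image of C × C. So z is a
    -- quotient of differences of every `Φ i`, hence lies in Q.
    Q⇔formula : ∀ v → ⟦ Q-formula ⟧ v ⇔ ⌜ Q ⌝ v
    Q⇔formula (z ∷ []) = mk⇔
      (λ { (a , b , x , y , Φa , Φb , Φx , Φy , x-y≢0 , e) →
        quotient-in-all z (in-all a b x y z Φa Φb Φx Φy x-y≢0 e) })
      (λ { (_ , _ , (a , b , Ya , Yb , refl) , (x , y , Yx , Yy , refl) , x-y≢0 , e) →
        a , b , x , y , Y⊆Φ i₀ Ya , Y⊆Φ i₀ Yb , Y⊆Φ i₀ Yx , Y⊆Φ i₀ Yy , x-y≢0 , e })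
      where
      stays : ∀ a b x y z → a ∈ Φ i₀ → b ∈ Φ i₀ → x ∈ Φ i₀ → y ∈ Φ i₀ → x ⊖ y ≢ 0ᶠ →
        z ⊗ (x ⊖ y) ≡ a ⊖ b → ∀ {c c′} → c ∈ Φ i₀ → c′ ∈ Φ i₀ → c ⊕ z ⊗ c′ ∈ Top.E
      stays a b x y z Φa Φb Φx Φy x-y≢0 eq {c} {c′} Φc Φc′ = em⇒dne em λ ¬p →
        proj₂ Φ⇒R (c ∷ c′ ∷ a ∷ b ∷ x ∷ y ∷ [])
          (λ { zero → Φc ; (suc zero) → Φc′ ; (suc (suc zero)) → Φa ; (suc (suc (suc zero))) → Φb
             ; (suc (suc (suc (suc zero)))) → Φx ; (suc (suc (suc (suc (suc zero))))) → Φy })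
          (z , x-y≢0 , eq , ¬p)
      in-all : ∀ a b x y z → a ∈ Φ i₀ → b ∈ Φ i₀ → x ∈ Φ i₀ → y ∈ Φ i₀ → x ⊖ y ≢ 0ᶠ →
        z ⊗ (x ⊖ y) ≡ a ⊖ b → ∀ i → DifferenceQuotient (Φ i) z
      in-all a b x y z Φa Φb Φx Φy x-y≢0 e′ i = difference-quotient-mono {C} {Φ i} {z} (Φ-++ˡ i i₀)
        (difference-quotient C Top.E {100 ℕ.+ e} z (ℕ.s≤s ℕ.z≤n)
          (⊇Y⊀ (100 ℕ.+ e) lower C (Y⊆Φ (i List.++ i₀)))
          (≺-mono Top.E (180+e≤ e) Top.E≺)
          (λ c c′ Cc Cc′ → stays a b x y z Φa Φb Φx Φy x-y≢0 e′ (Φ-++ʳ i i₀ Cc) (Φ-++ʳ i i₀ Cc′)))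
        where
        C = Φ (i List.++ i₀)

  -- Choice of the unit

  abstract
    -- The search descends from an archimedean bound for d and succeeds at the latest when e reaches
    -- 0, since nε ≤ q ≤ d.
    rescale : ∀ {q ε} n → 0ℚ ℚ.< ε → n ∙ ε ℚ.≤ q → ¬ cut d q → d < ∞ →
      ∃[ e ] ¬ cut d ((n ℕ.+ e) ∙ ε) × cut d (suc (n ℕ.+ e) ∙ ε)
    rescale {q} {ε} n 0<ε nε≤q q≤d (r , d<r , _) = search m
      (upper d d<r (ℚₚ.≤-trans r≤mε (∙-mono 0<ε (ℕₚ.m≤n+m m n))))
      where
      bound : ∃[ m ] r ℚ.≤ m ∙ ε
      bound = archimedean 0<ε r
      m : ℕ
      m = proj₁ bound
      r≤mε : r ℚ.≤ m ∙ ε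
      r≤mε = proj₂ bound
      search : ∀ m → cut d ((n ℕ.+ m) ∙ ε) → ∃[ e ] ¬ cut d ((n ℕ.+ e) ∙ ε) × cut d (suc (n ℕ.+ e) ∙ ε)
      search zero c = ⊥-elim (q≤d (upper d (subst (λ k → cut d (k ∙ ε)) (ℕₚ.+-identityʳ n) c) nε≤q))
      search (suc m) c with em {P = cut d ((n ℕ.+ m) ∙ ε)}
      ... | yes c′ = search m c′
      ... | no ¬c = m , ¬c , subst (λ k → cut d (k ∙ ε)) (ℕₚ.+-suc n m) c

    distinct-elements : ∀ {q} → 0ℚ ℚ.< q → ¬ cut d q → ∃[ x ] ∃[ y ] Y x × Y y × x ⊖ y ≢ 0ᶠ
    distinct-elements {q} 0<q q≤d = em⇒dne em λ ¬p →
      let singleton : ∀ c → ¬ (∀ {y} → Y y → y ≡ c)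
          singleton c Y⊆c = q≤d (∣∣⇒δᵗ (var zero == con c) (λ { {y ∷ []} Yy → Y⊆c Yy })
            (∣∣-finite (var zero == con c) ((c ∷ []) List.∷ List.[] , λ { {y ∷ []} refl → here refl }) (lift 0<q)))
      -- An element y would force Y ⊆ {y}, which is excluded. So Y is empty and lies in {0}, which
      -- is excluded as well.
      in singleton 0ᶠ λ {y} Yy → ⊥-elim (singleton y λ {x} Yx →
           x-y≡0⇒x≡y (em⇒dne em λ x-y≢0 → ¬p (x , y , Yx , Yy , x-y≢0)))

  module _ (0<YY-Y : 0∞ < δᵗ ⌜ Y *ˢ Y -ˢ Y ⌝) (YY-Y≈Y : δᵗ ⌜ Y *ˢ Y -ˢ Y ⌝ ≈ δᵗ ⌜ Y ⌝)
    (Y<∞ : δᵗ ⌜ Y ⌝ < ∞) where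

    private
      -- A positive rational that is at most δ(YY - Y), hence at most d; it limits how coarse the
      -- unit may be.
      q : ℚ
      q = proj₁ 0<YY-Y

      0<q : 0ℚ ℚ.< q
      0<q = lower (proj₁ (proj₂ 0<YY-Y))

      q≤d : ¬ cut d q
      q≤d c = proj₂ (proj₂ 0<YY-Y) (proj₁ YY-Y≈Y c)

      points = distinct-elements 0<q q≤d

      module AtUnit {ε} (0<ε : 0ℚ ℚ.< ε) (100ε≤q : 100 ∙ ε ℚ.≤ q) where
        scale = rescale 100 0<ε 100ε≤q q≤d Y<∞
        open Scale (proj₁ YY-Y≈Y) (proj₁ (proj₂ (proj₂ points))) (proj₁ (proj₂ (proj₂ (proj₂ points))))
          (proj₂ (proj₂ (proj₂ (proj₂ points)))) 0<ε (proj₁ scale) (proj₁ (proj₂ scale)) (proj₂ (proj₂ scale)) public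

      unit = small-unit 0<q
      module Unit = AtUnit (proj₁ (proj₂ unit)) (proj₂ (proj₂ unit))

    Q-isSubfield : IsSubfield Q
    Q-isSubfield = Unit.Q-subfield

    Q-definable : Definable F ⌜ Q ⌝
    Q-definable = redefine Unit.Q-formula Unit.Q⇔formula

    -- The dimension of Q

    private
      -- Q does not depend on the unit, so it lies in the set `E` of every sufficiently fine unit,
      -- and that set exceeds d by at most 80 units.
      ∣Q∣< : ∀ {p r ε} → cut d p → (0<ε : 0ℚ ℚ.< ε) → 100 ∙ ε ℚ.≤ q → 100 ∙ ε ℚ.≤ r ℚ.- p →
             cut ∣ Unit.Q-formula ∣ r
      ∣Q∣< {p} {r} {ε} d<p 0<ε 100ε≤q 100ε≤r-p = ∣∣-mono Unit.Q-formula Small.Top.E (λ {v} → Q-formula⊆E v)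
        (below 80 (100 ℕ.+ proj₁ Small.scale) Small.Top.E≺ (proj₁ (proj₂ Small.scale))
          (ℚₚ.≤-trans (∙-mono 0<ε {80} {100} (ℕₚ.m≤m+n 80 20)) 100ε≤r-p))
        where
        module Small = AtUnit 0<ε 100ε≤q
        open DimensionTheory.Counting em S F dim 0<ε
        Q-formula⊆E : ∀ v → ⟦ Unit.Q-formula ⟧ v → ⟦ Small.Top.E ⟧ v
        Q-formula⊆E (z ∷ []) p = Small.Q⊆E (to (Unit.Q⇔formula (z ∷ [])) p)
        below : ∀ m n → Small.Top.E ≺ m ℕ.+ n → ¬ cut d (n ∙ ε) → m ∙ ε ℚ.≤ r ℚ.- p → cut ∣ Small.Top.E ∣ r
        below m n ⟨ E≺ ⟩ n≤d mε≤r-p = upper ∣ Small.Top.E ∣ E≺ (begin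
          (m ℕ.+ n) ∙ ε          ≡⟨ ∙-homo-+ ε m n ⟩
          m ∙ ε ℚ.+ n ∙ ε        ≤⟨ ℚₚ.+-mono-≤ mε≤r-p (ℚₚ.<⇒≤ (ℚₚ.≰⇒> λ p≤nε → n≤d (upper d d<p p≤nε))) ⟩
          (r ℚ.- p) ℚ.+ p        ≡⟨ ℚₚ.+-assoc r (ℚ.- p) p ⟩
          r ℚ.+ (ℚ.- p ℚ.+ p)    ≡⟨ cong (r ℚ.+_) (ℚₚ.+-inverseˡ p) ⟩
          r ℚ.+ 0ℚ               ≡⟨ ℚₚ.+-identityʳ r ⟩
          r                      ∎)
          where open ℚₚ.≤-Reasoning

    δQ≤δY : δ Q-definable ≤ δᵗ ⌜ Y ⌝
    δQ≤δY {r} d<r =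
      -- With p strictly between d and r, the unit is taken so fine that 100 units fit both below q
      -- and into r - p.
      let p , p<r , d<p = rounded d d<r
          η , 0<η , η≤q , η≤r-p = common-lower-bound 0<q (p<q⇒0<q-p p<r)
          ε , 0<ε , 100ε≤η = small-unit 0<η
      in proj₂ (∣∣-redefine Unit.Q-formula Unit.Q⇔formula)
           (∣Q∣< d<p 0<ε (ℚₚ.≤-trans 100ε≤η η≤q) (ℚₚ.≤-trans 100ε≤η η≤r-p))

    δY≤δQ : δᵗ ⌜ Y ⌝ ≤ δ Q-definable
    δY≤δQ c = ∣∣⇒δᵗ Unit.Q-formula
      (λ { {y ∷ []} Yy → from (Unit.Q⇔formula (y ∷ [])) (Unit.Y⊆Q Yy) })
      (proj₁ (∣∣-redefine Unit.Q-formula Unit.Q⇔formula) c)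

theorem6p1 :
  (∀ {a} → ExcludedMiddle a) →
  ∀ {ℓ : Level} {L : Language ℓ} (S : RingSymbols L)
  (T : Theory L) → Complete T → ExpandsFields S T →
  (F : Structure L) → F ⊨ T →
  (K : Set ℓ) → ℕ ↣ K → Saturated F K →
  (dim : Dimension F) →
  let open Dimension dim
      open FieldOps S F
  in
  (Y : Pred (Structure.Carrier F) ℓ) → TypeDefinable F K ⌜ Y ⌝ →
  0∞ < δᵗ ⌜ Y *ˢ Y -ˢ Y ⌝ →
  δᵗ ⌜ Y *ˢ Y -ˢ Y ⌝ ≈ δᵗ ⌜ Y ⌝ →
  δᵗ ⌜ Y ⌝ < ∞ →
  IsSubfield ((Y -ˢ Y) /ˢ (Y -ˢ Y)) ×
  (Σ[ d ∈ Definable F ⌜ (Y -ˢ Y) /ˢ (Y -ˢ Y) ⌝ ] δ d ≈ δᵗ ⌜ Y ⌝)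
theorem6p1 em S T _ expandsFields F F⊨T K ℕ↣K saturated dim Y (params , Γ , _ , Y≐Γ) 0<YY-Y YY-Y≈Y Y<∞ =
  Q-isSubfield 0<YY-Y YY-Y≈Y Y<∞ , Q-definable 0<YY-Y YY-Y≈Y Y<∞ ,
  δQ≤δY 0<YY-Y YY-Y≈Y Y<∞ , δY≤δQ 0<YY-Y YY-Y≈Y Y<∞
  where
  open DifferenceQuotients em S F (expandsFields F F⊨T) ℕ↣K saturated dim Y params Γ Y≐Γ
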